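{- For all integers $n>0$ and $k>0$, \[ |\mathcal{C}_n^k|=\sum_{j=0}^{k}\left\langle k\atop j\right\rangle\sum_{m=0}^{j-1}(-1)^m\binom{j-1}{m}(k+1-m)^n=B_{n,k}. \]
   Context: A Callan permutation of $[n+k]=\{1,2,\ldots,n+k\}$ is a permutation (written as a word $\pi_1\pi_2\cdots\pi_{n+k}$) such that every substring of consecutive entries all of whose entries lie in $N=\{1,\ldots,n\}$, or all of whose entries lie in $K=\{n+1,\ldots,n+k\}$, is increasing. $\mathcal{C}_n^k$ denotes the set of Callan permutations of $[n+k]$. The poly-Bernoulli numbers are defined by $\sum_{n\ge 0}B_n^{(k)}\frac{x^n}{n!}=\frac{\mathrm{Li}_k(1-e^{ -x})}{1-e^{ -x}}$ with $\mathrm{Li}_k(z)=\sum_{i\ge1} z^i/i^k$, and $B_{n,k}:=B_n^{(-k)}$. The Eulerian number $\left\langle k\atop j\right\rangle$ is the number of permutations of $[k]$ with exactly $j-1$ descents (equivalently, with $j$ maximal ascending runs); in particular $\left\langle k\atop 0\right\rangle=0$ for $k>0$ (so the $j=0$ term, whose inner sum is empty, contributes $0$). -}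

module Defs where

open import Data.Bool using (Bool; true; false; _∧_; not; if_then_else_)
open import Data.Nat as ℕ using (ℕ; zero; suc; _∸_; _<ᵇ_; _≡ᵇ_; _≤ᵇ_)
open import Data.Nat.Combinatorics using (_C_)
open import Data.Integer as ℤ using (ℤ; +_; -1ℤ)
open import Data.Bool.ListAction using (all; any)
open import Data.List using (List; []; _∷_; map; concatMap; length; filterᵇ; upTo; applyUpTo; inits; tails; concat)

Σℤ : ℕ → (ℕ → ℤ) → ℤ
Σℤ zero    f = + 0
Σℤ (suc n) f = Σℤ n f ℤ.+ f n

words : ℕ → List ℕ → List (List ℕ)
words zero    as = [] ∷ []
words (suc l) as = concatMap (λ a → map (a ∷_) (words l as)) as

range1 : ℕ → List ℕ
range1 N = applyUpTo suc N

distinct : List ℕ → Bool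
distinct []       = true
distinct (x ∷ xs) = not (any (x ≡ᵇ_) xs) ∧ distinct xs

perms : ℕ → List (List ℕ)
perms N = filterᵇ distinct (words N (range1 N))

increasing : List ℕ → Bool
increasing []           = true
increasing (x ∷ [])     = true
increasing (x ∷ y ∷ ys) = (x <ᵇ y) ∧ increasing (y ∷ ys)

factors : List ℕ → List (List ℕ)
factors w = concatMap inits (tails w)

inN : ℕ → ℕ → Bool
inN n x = (1 ≤ᵇ x) ∧ (x ≤ᵇ n)

inK : ℕ → ℕ → ℕ → Bool
inK n k x = (suc n ≤ᵇ x) ∧ (x ≤ᵇ n ℕ.+ k)

isCallan : ℕ → ℕ → List ℕ → Bool
isCallan n k π =
  all (λ s → if all (inN n) s then increasing s
             else if all (inK n k) s then increasing s else true)
      (factors π)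

callan : ℕ → ℕ → List (List ℕ)
callan n k = filterᵇ (isCallan n k) (perms (n ℕ.+ k))

numCallan : ℕ → ℕ → ℕ
numCallan n k = length (callan n k)

descents : List ℕ → ℕ
descents []           = 0
descents (x ∷ [])     = 0
descents (x ∷ y ∷ ys) = (if y <ᵇ x then 1 else 0) ℕ.+ descents (y ∷ ys)

runs : List ℕ → ℕ
runs []       = 0
runs (x ∷ xs) = suc (descents (x ∷ xs))

eulerian : ℕ → ℕ → ℕ
eulerian k j = length (filterᵇ (λ π → runs π ≡ᵇ j) (perms k))

innerSum : ℕ → ℕ → ℕ → ℤ
innerSum n k zero    = + 0
innerSum n k (suc j') =
  Σℤ (suc j') (λ m → (-1ℤ ℤ.^ m) ℤ.* + (j' C m) ℤ.* (((+ suc k) ℤ.- (+ m)) ℤ.^ n))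

eulerSum : ℕ → ℕ → ℤ
eulerSum n k = Σℤ (suc k) (λ j → + eulerian k j ℤ.* innerSum n k j)

-- Poly-Bernoulli numbers via exponential generating functions.
-- An EGF Σ aₙ xⁿ/n! is represented by its coefficient sequence a : ℕ → ℤ.

EGF : Set
EGF = ℕ → ℤ

_⊛_ : EGF → EGF → EGF
(a ⊛ b) n = Σℤ (suc n) (λ j → + (n C j) ℤ.* a j ℤ.* b (n ∸ j))

egfOne : EGF
egfOne zero    = + 1
egfOne (suc n) = + 0

_^ₑ_ : EGF → ℕ → EGF
a ^ₑ zero  = egfOne
a ^ₑ suc m = a ⊛ (a ^ₑ m)

oneMinusExpNeg : EGF
oneMinusExpNeg zero    = + 0
oneMinusExpNeg (suc n) = -1ℤ ℤ.^ n

-- B_n^{(-k)} = n! [xⁿ] Li_{-k}(1-e^{-x})/(1-e^{-x})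
--            = [xⁿ/n!] Σ_{i≥1} i^k (1-e^{-x})^{i-1}.
-- Since 1-e^{-x} has zero constant term, (1-e^{-x})^{i-1} contributes
-- nothing to the coefficient of xⁿ once i-1 > n, so the sum is finite.
polyBernoulli : ℕ → ℕ → ℤ
polyBernoulli n k = Σℤ (suc n) (λ i → ((+ suc i) ℤ.^ k) ℤ.* (oneMinusExpNeg ^ₑ i) n)

{-# OPTIONS --safe #-}
-- All three quantities are the value at 1 of an iterated operator
-- (𝓓 g)(r) = r g(r + 1) − (r − 1) g(r).
-- Build a Callan permutation by inserting first the letters of K and then those
-- of N, each time in increasing order.  A letter of N must go to the end of one of
-- the k + 1 gaps between letters of K, and every descent inside K has to be
-- filled; so a permutation of K with d descents has ∇ᵈ(rⁿ)(k + 1) completions,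
-- which is also the inner sum of the theorem.  Inserting the maximal letter of
-- K turns the sum of ∇ᵈg(k + 1) over permutations into that of ∇ᵈ(𝓓 g)(k), so the
-- total is (𝓓ᵏ rⁿ)(1).  On the other hand u = 1 − e⁻ˣ satisfies
-- (uⁱ)′ = i(uⁱ⁻¹ − uⁱ), which makes the poly-Bernoulli number (𝓓ⁿ rᵏ)(1).
-- Finally 𝓓 and multiplication by r are transposes of each other in the
-- binomial basis r ↦ C(r − 1, i), so n and k can be exchanged.
module Submission where

open import Defs
open import Data.Bool using (Bool; true; false; T; not; _∧_; if_then_else_)
open import Data.Bool.ListAction using (any; all)
open import Data.Bool.Properties using (T-≡; T-∧; T?)
open import Data.Empty using (⊥)
open import Data.Integer using (ℤ; +_; -1ℤ; 0ℤ; 1ℤ; _+_; _*_; _-_; _^_)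
open import Data.Integer.Properties using (+-comm; +-assoc; +-identityˡ; +-identityʳ; +-inverseʳ; *-comm; *-assoc; *-identityˡ; *-identityʳ; *-zeroˡ; *-zeroʳ; *-distribˡ-+; *-distribʳ-+; -1*i≡-i)
open import Data.Integer.Tactic.RingSolver using (solve-∀)
open import Data.List using (List; []; _∷_; _++_; map; concatMap; filter; filterᵇ; length; applyDownFrom; inits)
open import Data.List.Membership.Propositional using (_∈_; _∉_; find; lose)
open import Data.List.Membership.Propositional.Properties using (∈-map⁺; ∈-map⁻; ∈-++⁺ˡ; ∈-++⁺ʳ; ∈-++⁻; ∈-concatMap⁺; ∈-concatMap⁻; ∈-filter⁺; ∈-filter⁻; ∈-∃++)
open import Data.List.Membership.Propositional.Properties.WithK using (unique∧set⇒bag)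
open import Data.List.Properties using (∷-injectiveˡ; ∷-injectiveʳ; length-applyUpTo; length-applyDownFrom; reverse-applyUpTo; filter-accept; filter-reject; filter-all; filter-none; filter-++)
open import Data.List.Relation.Binary.BagAndSetEquality using (∼bag⇒↭)
open import Data.List.Relation.Binary.Permutation.Propositional using (_↭_; ↭-sym; ↭-trans; ↭-refl; ↭-reflexive; prep; swap; ↭⇒↭ₛ; module _↭_)
open import Data.List.Relation.Binary.Permutation.Propositional.Properties using (All-resp-↭; ∈-resp-↭; ↭-length; shift; drop-mid; ↭-empty-inv; ↭-reverse; ++-comm; filter-↭)
import Data.List.Relation.Binary.Permutation.Setoid.Properties as Setoid↭
open import Data.List.Relation.Unary.All as All using (All; []; _∷_)
import Data.List.Relation.Unary.All.Properties as All
open import Data.List.Relation.Unary.AllPairs using (AllPairs; []; _∷_)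
import Data.List.Relation.Unary.AllPairs.Properties as AllPairs
open import Data.List.Relation.Unary.Any as Any using (here; there)
open import Data.List.Relation.Unary.Any.Properties using (any⁺; any⁻)
open import Data.List.Relation.Unary.Linked as Linked using (Linked; []; [-]; _∷_)
import Data.List.Relation.Unary.Linked.Properties as Linked
open import Data.List.Relation.Unary.Unique.Propositional using (Unique)
open import Data.List.Relation.Unary.Unique.Propositional.Properties as Unique using (Unique[x∷xs]⇒x∉xs)
open import Data.Nat as ℕ using (ℕ; zero; suc; pred; _∸_; _≤_; _<_; _>_; z≤n; s≤s; _≡ᵇ_; _<ᵇ_; _≤ᵇ_)
open import Data.Nat.Combinatorics using (_C_; nCk+nC[k+1]≡[n+1]C[k+1]; k>n⇒nCk≡0)
import Data.Nat.Properties as ℕ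
open import Data.Product using (_×_; _,_; proj₁; proj₂; ∃)
open import Data.Sum using (inj₁; inj₂)
open import Function using (_∘_; id; const; mk⇔; _⇔_; Equivalence)
open import Relation.Binary.PropositionalEquality
open import Relation.Nullary using (¬_; Dec; contradiction; yes; no)

private variable
  X Y : Set

-- Finite sums over initial segments of ℕ.

Σ-cong : ∀ n {f g : ℕ → ℤ} → (∀ i → i < n → f i ≡ g i) → Σℤ n f ≡ Σℤ n g
Σ-cong zero    h = refl
Σ-cong (suc n) h = cong₂ _+_ (Σ-cong n (λ i i<n → h i (ℕ.m<n⇒m<1+n i<n))) (h n ℕ.≤-refl)

Σ-cong′ : ∀ n {f g : ℕ → ℤ} → (∀ i → f i ≡ g i) → Σℤ n f ≡ Σℤ n g
Σ-cong′ n h = Σ-cong n (λ i _ → h i)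

Σ-zero : ∀ n {f : ℕ → ℤ} → (∀ i → f i ≡ 0ℤ) → Σℤ n f ≡ 0ℤ
Σ-zero zero    h = refl
Σ-zero (suc n) h = cong₂ _+_ (Σ-zero n h) (h n)

Σ-+ : ∀ n (f g : ℕ → ℤ) → Σℤ n (λ i → f i + g i) ≡ Σℤ n f + Σℤ n g
Σ-+ zero    f g = refl
Σ-+ (suc n) f g = trans (cong (_+ (f n + g n)) (Σ-+ n f g)) (medial (Σℤ n f) (Σℤ n g) (f n) (g n))
  where
  medial : ∀ a b c d → (a + b) + (c + d) ≡ (a + c) + (b + d)
  medial = solve-∀

Σ-* : ∀ n c (f : ℕ → ℤ) → Σℤ n (λ i → c * f i) ≡ c * Σℤ n f
Σ-* zero    c f = sym (*-zeroʳ c)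
Σ-* (suc n) c f = trans (cong (_+ c * f n) (Σ-* n c f)) (sym (*-distribˡ-+ c (Σℤ n f) (f n)))

Σ-- : ∀ n (f g : ℕ → ℤ) → Σℤ n (λ i → f i - g i) ≡ Σℤ n f - Σℤ n g
Σ-- zero    f g = refl
Σ-- (suc n) f g = trans (cong (_+ (f n - g n)) (Σ-- n f g)) (medial (Σℤ n f) (Σℤ n g) (f n) (g n))
  where
  medial : ∀ a b c d → (a - b) + (c - d) ≡ (a + c) - (b + d)
  medial = solve-∀

Σ-head : ∀ n (f : ℕ → ℤ) → Σℤ (suc n) f ≡ f 0 + Σℤ n (λ i → f (suc i))
Σ-head zero    f = +-comm 0ℤ (f 0)
Σ-head (suc n) f = trans (cong (_+ f (suc n)) (Σ-head n f)) (+-assoc (f 0) _ _)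

Σ-head-zero : ∀ n (f : ℕ → ℤ) → f 0 ≡ 0ℤ → Σℤ (suc n) f ≡ Σℤ n (λ i → f (suc i))
Σ-head-zero n f f0≡0 = trans (Σ-head n f) (trans (cong (_+ Σℤ n (λ i → f (suc i))) f0≡0) (+-identityˡ _))

Σ-last-zero : ∀ n (f : ℕ → ℤ) → f n ≡ 0ℤ → Σℤ (suc n) f ≡ Σℤ n f
Σ-last-zero n f fn≡0 = trans (cong (_+_ (Σℤ n f)) fn≡0) (+-identityʳ _)

Σ-truncate : ∀ m n {f : ℕ → ℤ} → (∀ i → n ≤ i → f i ≡ 0ℤ) → Σℤ (m ℕ.+ n) f ≡ Σℤ n f
Σ-truncate zero    n h = refl
Σ-truncate (suc m) n h =
  trans (Σ-last-zero (m ℕ.+ n) _ (h _ (ℕ.m≤n+m n m))) (Σ-truncate m n h)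

-- Pascal's rule splits a binomial sum into itself one order lower and a shifted copy. Both the
-- expansion of `∇` and the product rule for `⊛` rest on it.
Σ-pascal : ∀ n (f : ℕ → ℤ) →
  Σℤ (suc (suc n)) (λ i → + (suc n C i) * f i) ≡
  Σℤ (suc n) (λ i → + (n C i) * f i) + Σℤ (suc n) (λ i → + (n C i) * f (suc i))
Σ-pascal n f = begin
  Σℤ (suc (suc n)) (λ i → + (suc n C i) * f i)
    ≡⟨ Σ-head (suc n) _ ⟩
  1ℤ * f 0 + Σℤ (suc n) (λ i → + (suc n C suc i) * f (suc i))
    ≡⟨ cong (_+_ (1ℤ * f 0)) (trans (Σ-cong′ (suc n) split) (Σ-+ (suc n) _ _)) ⟩
  1ℤ * f 0 + (Σℤ (suc n) (λ i → + (n C i) * f (suc i)) + Σℤ (suc n) (λ i → + (n C suc i) * f (suc i)))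
    ≡⟨ shuffle (1ℤ * f 0) _ _ ⟩
  (1ℤ * f 0 + Σℤ (suc n) (λ i → + (n C suc i) * f (suc i))) + Σℤ (suc n) (λ i → + (n C i) * f (suc i))
    ≡⟨ cong (_+ Σℤ (suc n) (λ i → + (n C i) * f (suc i))) (trans (sym (Σ-head (suc n) _)) (Σ-last-zero (suc n) _ last)) ⟩
  Σℤ (suc n) (λ i → + (n C i) * f i) + Σℤ (suc n) (λ i → + (n C i) * f (suc i)) ∎
  where
  open ≡-Reasoning
  split : ∀ i → + (suc n C suc i) * f (suc i) ≡ + (n C i) * f (suc i) + + (n C suc i) * f (suc i)
  split i = trans (cong (λ c → + c * f (suc i)) (sym (nCk+nC[k+1]≡[n+1]C[k+1] n i)))
                  (*-distribʳ-+ (f (suc i)) (+ (n C i)) (+ (n C suc i)))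
  shuffle : ∀ a b c → a + (b + c) ≡ (a + c) + b
  shuffle = solve-∀
  last : + (n C suc n) * f (suc n) ≡ 0ℤ
  last rewrite k>n⇒nCk≡0 (ℕ.n<1+n n) = *-zeroˡ (f (suc n))

-- Backward differences of functions on ℤ

∇ : ℕ → (ℤ → ℤ) → ℤ → ℤ
∇ zero    g x = g x
∇ (suc d) g x = ∇ d g x - ∇ d g (x - 1ℤ)

-- In `Σ-pascal` the shifted copy carries one more sign and starts at `x - 1ℤ`, so it is the
-- subtracted term of `∇ (suc d)`. For a power function at `+ suc k` the left side is the inner sum
-- of the theorem.
∇-expand : ∀ d g x → Σℤ (suc d) (λ m → (-1ℤ ^ m) * + (d C m) * g (x - + m)) ≡ ∇ d g x
∇-expand zero g x = trans (cong (λ y → 0ℤ + 1ℤ * g y) (+-identityʳ x)) (unit (g x))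
  where
  unit : ∀ a → 0ℤ + 1ℤ * a ≡ a
  unit = solve-∀
∇-expand (suc d) g x = begin
  Σℤ (suc (suc d)) (λ m → (-1ℤ ^ m) * + (suc d C m) * g (x - + m))
    ≡⟨ Σ-cong′ (suc (suc d)) (λ m → comm (-1ℤ ^ m) (+ (suc d C m)) _) ⟩
  Σℤ (suc (suc d)) (λ m → + (suc d C m) * ((-1ℤ ^ m) * g (x - + m)))
    ≡⟨ Σ-pascal d _ ⟩
  Σℤ (suc d) (λ m → + (d C m) * ((-1ℤ ^ m) * g (x - + m))) +
  Σℤ (suc d) (λ m → + (d C m) * ((-1ℤ ^ suc m) * g (x - + suc m)))
    ≡⟨ cong₂ _+_ (trans (Σ-cong′ (suc d) (λ m → sym (comm (-1ℤ ^ m) (+ (d C m)) _))) (∇-expand d g x))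
                 (trans (trans (Σ-cong′ (suc d) neg) (Σ-* (suc d) -1ℤ _)) (cong (-1ℤ *_) (∇-expand d g (x - 1ℤ)))) ⟩
  ∇ d g x + -1ℤ * ∇ d g (x - 1ℤ)
    ≡⟨ cong (_+_ (∇ d g x)) (-1*i≡-i _) ⟩
  ∇ (suc d) g x ∎
  where
  open ≡-Reasoning
  comm : ∀ s c y → s * c * y ≡ c * (s * y)
  comm = solve-∀
  assoc : ∀ a s c y → c * (a * s * y) ≡ a * (s * c * y)
  assoc = solve-∀
  sub-suc : ∀ x y → x - (1ℤ + y) ≡ x - 1ℤ - y
  sub-suc = solve-∀
  neg : ∀ m → + (d C m) * ((-1ℤ ^ suc m) * g (x - + suc m)) ≡
              -1ℤ * ((-1ℤ ^ m) * + (d C m) * g (x - 1ℤ - + m))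
  neg m = trans (cong (λ y → + (d C m) * ((-1ℤ ^ suc m) * g y)) (sub-suc x (+ m)))
                (assoc -1ℤ (-1ℤ ^ m) (+ (d C m)) _)

∇-cong : ∀ d {g h : ℤ → ℤ} → (∀ x → g x ≡ h x) → ∀ x → ∇ d g x ≡ ∇ d h x
∇-cong zero    e x = e x
∇-cong (suc d) e x = cong₂ _-_ (∇-cong d e x) (∇-cong d e (x - 1ℤ))

∇-const : ∀ d c x → ∇ (suc d) (λ _ → c) x ≡ 0ℤ
∇-const zero    c x = +-inverseʳ c
∇-const (suc d) c x = cong₂ _-_ (∇-const d c x) (∇-const d c (x - 1ℤ))

-- The Leibniz rule for multiplication by r, in the shape of `insertN` with c = x. At d = 0 the
-- factor `+ d` kills the meaningless value of `pred`.
∇-id* : ∀ d g x → ∇ d (λ r → r * g r) x ≡ (x - + d) * ∇ d g x + + d * ∇ (ℕ.pred d) g x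
∇-id* zero          g x = ring x (g x)
  where
  ring : ∀ x a → x * a ≡ (x - 0ℤ) * a + 0ℤ * a
  ring = solve-∀
-- `pred` lowers the order only from here on, so order 1 is a second base case.
∇-id* (suc zero)    g x = ring x (g x) (g (x - 1ℤ))
  where
  ring : ∀ x a b → x * a - (x - 1ℤ) * b ≡ (x - 1ℤ) * (a - b) + 1ℤ * a
  ring = solve-∀
∇-id* (suc (suc d)) g x =
  trans (cong₂ _-_ (∇-id* (suc d) g x) (∇-id* (suc d) g (x - 1ℤ)))
        (ring x (+ d) (∇ d g x) (∇ d g (x - 1ℤ)) (∇ d g (x - 1ℤ - 1ℤ)))
  where
  ring : ∀ x d a b c →
    ((x - (1ℤ + d)) * (a - b) + (1ℤ + d) * a) - ((x - 1ℤ - (1ℤ + d)) * (b - c) + (1ℤ + d) * b) ≡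
    (x - (1ℤ + (1ℤ + d))) * ((a - b) - (b - c)) + (1ℤ + (1ℤ + d)) * (a - b)
  ring = solve-∀

-- The operator 𝓓

-- The shift is written `1ℤ + x` because at `+ n` this computes to `+ suc n`.
𝓓 : (ℤ → ℤ) → ℤ → ℤ
𝓓 g x = x * g (1ℤ + x) - (x - 1ℤ) * g x

𝓓^ : ℕ → (ℤ → ℤ) → ℤ → ℤ
𝓓^ zero    g = g
𝓓^ (suc k) g = 𝓓^ k (𝓓 g)

1+x-1 : ∀ x → 1ℤ + x - 1ℤ ≡ x
1+x-1 = solve-∀

1+[x-1] : ∀ x → 1ℤ + (x - 1ℤ) ≡ x
1+[x-1] = solve-∀

-- By induction on d. At x = k + 1 the two coefficients are d + 1 and k - d, those of
-- `insertionSum`.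
∇-𝓓 : ∀ d g x → ∇ d (𝓓 g) x ≡ + suc d * ∇ d g (1ℤ + x) + (x - + suc d) * ∇ (suc d) g (1ℤ + x)
∇-𝓓 zero g x rewrite 1+x-1 x = ring x (g (1ℤ + x)) (g x)
  where
  ring : ∀ x a b → x * a - (x - 1ℤ) * b ≡ 1ℤ * a + (x - 1ℤ) * (a - b)
  ring = solve-∀
∇-𝓓 (suc d) g x =
  trans (cong₂ _-_ (∇-𝓓 d g x) (∇-𝓓 d g (x - 1ℤ))) step
  where
  ring : ∀ x d a b c →
    ((1ℤ + d) * a + (x - (1ℤ + d)) * (a - b)) - ((1ℤ + d) * b + (x - 1ℤ - (1ℤ + d)) * (b - c)) ≡
    (1ℤ + (1ℤ + d)) * (a - b) + (x - (1ℤ + (1ℤ + d))) * ((a - b) - (b - c))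
  ring = solve-∀
  step : (+ suc d * ∇ d g (1ℤ + x) + (x - + suc d) * ∇ (suc d) g (1ℤ + x)) -
         (+ suc d * ∇ d g (1ℤ + (x - 1ℤ)) + (x - 1ℤ - + suc d) * ∇ (suc d) g (1ℤ + (x - 1ℤ))) ≡
         + suc (suc d) * ∇ (suc d) g (1ℤ + x) + (x - + suc (suc d)) * ∇ (suc (suc d)) g (1ℤ + x)
  step rewrite 1+x-1 x | 1+[x-1] x = ring x (+ d) (∇ d g (1ℤ + x)) (∇ d g x) (∇ d g (x - 1ℤ))

-- The sum of G(descents π) over the permutations π of k letters: the new maximum
-- of a permutation with d descents preserves their number in d + 1 positions
-- and increases it in the others.
insertionSum : ℕ → (ℕ → ℤ) → ℤ
insertionSum zero    G = G 0
insertionSum (suc k) G = insertionSum k (λ d → + suc d * G d + (+ k - + d) * G (suc d))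

insertionSum-cong : ∀ k {G H : ℕ → ℤ} → (∀ d → G d ≡ H d) → insertionSum k G ≡ insertionSum k H
insertionSum-cong zero    e = e 0
insertionSum-cong (suc k) e =
  insertionSum-cong k (λ d → cong₂ (λ a b → + suc d * a + (+ k - + d) * b) (e d) (e (suc d)))

-- Each insertion of a maximum becomes one application of `𝓓` and lowers the evaluation point by
-- one, so k insertions lead from k + 1 down to 1.
insertionSum-∇ : ∀ k g → insertionSum k (λ d → ∇ d g (+ suc k)) ≡ 𝓓^ k g 1ℤ
insertionSum-∇ zero    g = refl
insertionSum-∇ (suc k) g =
  trans (insertionSum-cong k step) (insertionSum-∇ k (𝓓 g))
  where
  cancel : ∀ k d → 1ℤ + k - (1ℤ + d) ≡ k - d
  cancel = solve-∀
  step : ∀ d → + suc d * ∇ d g (+ suc (suc k)) + (+ k - + d) * ∇ (suc d) g (+ suc (suc k)) ≡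
               ∇ d (𝓓 g) (+ suc k)
  step d = sym (trans (∇-𝓓 d g (+ suc k))
    (cong (λ c → + suc d * ∇ d g _ + c * ∇ (suc d) g _) (cancel (+ k) (+ d))))

-- Duality

-- A n i = i! S(n + 1, i + 1), the coefficient of C(r − 1, i) in rⁿ.
A : ℕ → ℕ → ℤ
A zero    zero    = 1ℤ
A zero    (suc i) = 0ℤ
A (suc n) zero    = A n zero
A (suc n) (suc i) = + suc (suc i) * A n (suc i) + + suc i * A n i

A-vanish : ∀ n i → n < i → A n i ≡ 0ℤ
A-vanish zero    (suc i) _         = refl
A-vanish (suc n) (suc i) (s≤s n<i)
  rewrite A-vanish n (suc i) (ℕ.m<n⇒m<1+n n<i) | A-vanish n i n<i =
  cong₂ _+_ (*-zeroʳ (+ suc (suc i))) (*-zeroʳ (+ suc i))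

-- The coefficient of C(r − 1, i) in the expansion of g.
δ : ℕ → (ℤ → ℤ) → ℤ
δ i g = ∇ i g (+ suc i)

-- `∇-id*` at the point i + 2 gives the recurrence of `A`, once ∇ⁱ at i + 2 is written as
-- `δ (suc i)` plus `δ i`.
δ-power : ∀ n i → δ i (_^ n) ≡ A n i
δ-power zero    zero    = refl
δ-power zero    (suc i) = ∇-const i 1ℤ (+ suc (suc i))
δ-power (suc n) zero    = trans (*-identityˡ _) (δ-power n zero)
δ-power (suc n) (suc i) = begin
  ∇ (suc i) (λ r → r * r ^ n) x
    ≡⟨ ∇-id* (suc i) (_^ n) x ⟩
  (x - + suc i) * ∇ (suc i) (_^ n) x + + suc i * ∇ i (_^ n) x
    ≡⟨ ring (+ i) (∇ i (_^ n) x) (∇ i (_^ n) (x - 1ℤ)) ⟩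
  + suc (suc i) * δ (suc i) (_^ n) + + suc i * δ i (_^ n)
    ≡⟨ cong₂ (λ a b → + suc (suc i) * a + + suc i * b) (δ-power n (suc i)) (δ-power n i) ⟩
  A (suc n) (suc i) ∎
  where
  open ≡-Reasoning
  x = + suc (suc i)
  ring : ∀ i a b → (1ℤ + (1ℤ + i) - (1ℤ + i)) * (a - b) + (1ℤ + i) * a ≡
                   (1ℤ + (1ℤ + i)) * (a - b) + (1ℤ + i) * b
  ring = solve-∀

-- At the point i + 1 the second coefficient of `∇-𝓓` vanishes. The remaining bidiagonal matrix is
-- the transpose of that of multiplication by r, found in `δ-power`.
δ-𝓓 : ∀ i g → δ i (𝓓 g) ≡ + suc i * (δ (suc i) g + δ i g)
δ-𝓓 i g = trans (∇-𝓓 i g (+ suc i)) (ring (+ i) (∇ i g (+ suc (suc i))) (∇ i g (+ suc i)))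
  where
  ring : ∀ i a b → (1ℤ + i) * a + (1ℤ + i - (1ℤ + i)) * (a - b) ≡ (1ℤ + i) * ((a - b) + b)
  ring = solve-∀

-- Applying `δ-𝓓` and collecting the coefficient of each `δ i` reproduces the recurrence of `A`:
-- this is where the transposition is used.
𝓓^-δ : ∀ k g → 𝓓^ k g 1ℤ ≡ Σℤ (suc k) (λ i → A k i * δ i g)
𝓓^-δ zero    g = sym (trans (+-identityˡ _) (*-identityˡ _))
𝓓^-δ (suc k) g = begin
  𝓓^ k (𝓓 g) 1ℤ
    ≡⟨ 𝓓^-δ k (𝓓 g) ⟩
  Σℤ (suc k) (λ i → A k i * δ i (𝓓 g))
    ≡⟨ trans (Σ-cong′ (suc k) (λ i → trans (cong (A k i *_) (δ-𝓓 i g)) (distr (A k i) (+ suc i) _ _))) (Σ-+ (suc k) _ _) ⟩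
  Σℤ (suc k) low + Σℤ (suc k) up
    -- The range is extended by the index k + 1, where `A k` vanishes, so that after splitting off
    -- index 0 both sums contribute to the same `δ (suc i)`.
    ≡⟨ cong (_+ Σℤ (suc k) up) (trans (sym (Σ-last-zero (suc k) low last)) (Σ-head (suc k) low)) ⟩
  (low 0 + Σℤ (suc k) (λ i → low (suc i))) + Σℤ (suc k) up
    ≡⟨ trans (+-assoc (low 0) _ _) (cong₂ _+_ (cong (_* δ 0 g) (*-identityˡ (A k 0))) (sym (Σ-+ (suc k) _ _))) ⟩
  A k 0 * δ 0 g + Σℤ (suc k) (λ i → low (suc i) + up i)
    ≡⟨ cong (_+_ (A k 0 * δ 0 g)) (Σ-cong′ (suc k) (λ i → sym (*-distribʳ-+ (δ (suc i) g) (+ suc (suc i) * A k (suc i)) (+ suc i * A k i)))) ⟩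
  A k 0 * δ 0 g + Σℤ (suc k) (λ i → A (suc k) (suc i) * δ (suc i) g)
    ≡⟨ Σ-head (suc k) (λ i → A (suc k) i * δ i g) ⟨
  Σℤ (suc (suc k)) (λ i → A (suc k) i * δ i g) ∎
  where
  open ≡-Reasoning
  low up : ℕ → ℤ
  low i = + suc i * A k i * δ i g
  up  i = + suc i * A k i * δ (suc i) g
  distr : ∀ a s u v → a * (s * (u + v)) ≡ s * a * v + s * a * u
  distr = solve-∀
  last : low (suc k) ≡ 0ℤ
  last rewrite A-vanish k (suc k) ℕ.≤-refl | *-zeroʳ (+ suc (suc k)) = *-zeroˡ (δ (suc k) g)

-- The summand is symmetric in k and n, but the natural range is not. Padding by `m` zero terms
-- allows both sums to have n + k + 1 terms.
𝓓^-power : ∀ m k n → 𝓓^ k (_^ n) 1ℤ ≡ Σℤ (m ℕ.+ suc k) (λ i → A k i * A n i)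
𝓓^-power m k n = trans (𝓓^-δ k (_^ n)) (trans (Σ-cong′ (suc k) (λ i → cong (A k i *_) (δ-power n i)))
  (sym (Σ-truncate m (suc k) (λ i k<i → trans (cong (_* A n i) (A-vanish k i k<i)) (*-zeroˡ (A n i))))))

𝓓^-duality : ∀ k n → 𝓓^ k (_^ n) 1ℤ ≡ 𝓓^ n (_^ k) 1ℤ
𝓓^-duality k n = begin
  𝓓^ k (_^ n) 1ℤ                               ≡⟨ 𝓓^-power n k n ⟩
  Σℤ (n ℕ.+ suc k) (λ i → A k i * A n i)       ≡⟨ Σ-cong′ (n ℕ.+ suc k) (λ i → *-comm (A k i) (A n i)) ⟩
  Σℤ (n ℕ.+ suc k) (λ i → A n i * A k i)       ≡⟨ cong (λ m → Σℤ m (λ i → A n i * A k i)) n+1+k≡k+1+n ⟩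
  Σℤ (k ℕ.+ suc n) (λ i → A n i * A k i)       ≡⟨ 𝓓^-power k n k ⟨
  𝓓^ n (_^ k) 1ℤ                               ∎
  where
  open ≡-Reasoning
  n+1+k≡k+1+n : n ℕ.+ suc k ≡ k ℕ.+ suc n
  n+1+k≡k+1+n = trans (ℕ.+-suc n k) (trans (cong suc (ℕ.+-comm n k)) (sym (ℕ.+-suc k n)))

-- Powers of 1 − e⁻ˣ

-- Shifting a coefficient sequence differentiates its exponential generating function, so this is
-- the product rule.
⊛-derivative : ∀ (a b : EGF) n →
  (a ⊛ b) (suc n) ≡ (a ⊛ (λ i → b (suc i))) n + ((λ i → a (suc i)) ⊛ b) n
⊛-derivative a b n = begin
  (a ⊛ b) (suc n)
    ≡⟨ Σ-cong′ (suc (suc n)) (λ j → *-assoc (+ (suc n C j)) (a j) _) ⟩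
  Σℤ (suc (suc n)) (λ j → + (suc n C j) * (a j * b (suc n ∸ j)))
    ≡⟨ Σ-pascal n _ ⟩
  Σℤ (suc n) (λ j → + (n C j) * (a j * b (suc n ∸ j))) + Σℤ (suc n) (λ j → + (n C j) * (a (suc j) * b (n ∸ j)))
    ≡⟨ cong₂ _+_ (Σ-cong (suc n) (λ { j (s≤s j≤n) → trans (sym (*-assoc (+ (n C j)) (a j) _)) (cong (λ m → + (n C j) * a j * b m) (ℕ.+-∸-assoc 1 j≤n)) }))
                 (Σ-cong′ (suc n) (λ j → sym (*-assoc (+ (n C j)) (a (suc j)) _))) ⟩
  (a ⊛ (λ i → b (suc i))) n + ((λ i → a (suc i)) ⊛ b) n ∎
  where open ≡-Reasoning

⊛-congˡ : ∀ {a a′ : EGF} (b : EGF) n → (∀ i → a i ≡ a′ i) → (a ⊛ b) n ≡ (a′ ⊛ b) n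
⊛-congˡ b n e = Σ-cong′ (suc n) (λ j → cong (λ x → + (n C j) * x * b (n ∸ j)) (e j))

⊛-congʳ : ∀ (a : EGF) {b b′ : EGF} n → (∀ i → b i ≡ b′ i) → (a ⊛ b) n ≡ (a ⊛ b′) n
⊛-congʳ a n e = Σ-cong′ (suc n) (λ j → cong (+ (n C j) * a j *_) (e (n ∸ j)))

⊛-identityˡ : ∀ (b : EGF) n → (egfOne ⊛ b) n ≡ b n
⊛-identityˡ b n = begin
  (egfOne ⊛ b) n
    ≡⟨ Σ-head n _ ⟩
  1ℤ * b n + Σℤ n (λ j → + (n C suc j) * 0ℤ * b (n ∸ suc j))
    ≡⟨ cong₂ _+_ (*-identityˡ (b n)) (Σ-zero n (λ j → trans (cong (_* b (n ∸ suc j)) (*-zeroʳ (+ (n C suc j)))) (*-zeroˡ (b (n ∸ suc j))))) ⟩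
  b n + 0ℤ
    ≡⟨ +-identityʳ (b n) ⟩
  b n ∎
  where open ≡-Reasoning

⊛-distribʳ-- : ∀ (a a′ b : EGF) n → ((λ i → a i - a′ i) ⊛ b) n ≡ (a ⊛ b) n - (a′ ⊛ b) n
⊛-distribʳ-- a a′ b n =
  trans (Σ-cong′ (suc n) (λ j → ring (+ (n C j)) (a j) (a′ j) (b (n ∸ j)))) (Σ-- (suc n) _ _)
  where
  ring : ∀ c a a′ b → c * (a - a′) * b ≡ c * a * b - c * a′ * b
  ring = solve-∀

⊛-scaled-- : ∀ s (a b b′ : EGF) n → (a ⊛ (λ i → s * (b i - b′ i))) n ≡ s * ((a ⊛ b) n - (a ⊛ b′) n)
⊛-scaled-- s a b b′ n =
  trans (Σ-cong′ (suc n) (λ j → ring s (+ (n C j)) (a j) (b (n ∸ j)) (b′ (n ∸ j))))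
  (trans (Σ-* (suc n) s _) (cong (s *_) (Σ-- (suc n) _ _)))
  where
  ring : ∀ s c a b b′ → c * a * (s * (b - b′)) ≡ s * (c * a * b - c * a * b′)
  ring = solve-∀

oneMinusExpNeg-derivative : ∀ n → oneMinusExpNeg (suc n) ≡ egfOne n - oneMinusExpNeg n
oneMinusExpNeg-derivative zero    = refl
oneMinusExpNeg-derivative (suc n) = trans (-1*i≡-i (-1ℤ ^ n)) (sym (+-identityˡ _))

U : ℕ → EGF
U i = oneMinusExpNeg ^ₑ i

-- The product rule together with u′ = 1 - u, where u = 1 - e⁻ˣ.
U-derivative : ∀ i n → U (suc i) (suc n) ≡ + suc i * (U i n - U (suc i) n)
U-derivative i n = begin
  (u ⊛ U i) (suc n)
    ≡⟨ ⊛-derivative u (U i) n ⟩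
  (u ⊛ (λ j → U i (suc j))) n + ((λ j → u (suc j)) ⊛ U i) n
    ≡⟨ cong₂ _+_ (inner i) outer ⟩
  + i * (U i n - U (suc i) n) + (U i n - U (suc i) n)
    ≡⟨ ring (+ i) (U i n - U (suc i) n) ⟩
  + suc i * (U i n - U (suc i) n) ∎
  where
  open ≡-Reasoning
  u = oneMinusExpNeg
  ring : ∀ i x → i * x + x ≡ (1ℤ + i) * x
  ring = solve-∀
  outer : ((λ j → u (suc j)) ⊛ U i) n ≡ U i n - U (suc i) n
  outer = trans (⊛-congˡ (U i) n oneMinusExpNeg-derivative)
          (trans (⊛-distribʳ-- egfOne u (U i) n) (cong (_- U (suc i) n) (⊛-identityˡ (U i) n)))
  -- The induction hypothesis for (uⁱ)′, multiplied by u, raises every exponent by one.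
  inner : ∀ i → (u ⊛ (λ j → U i (suc j))) n ≡ + i * (U i n - U (suc i) n)
  inner zero    = trans (Σ-zero (suc n) (λ j → *-zeroʳ (+ (n C j) * u j))) (sym (*-zeroˡ (U 0 n - U 1 n)))
  inner (suc i) = trans (⊛-congʳ u n (U-derivative i)) (⊛-scaled-- (+ suc i) u (U i) (U (suc i)) n)

-- The power uⁱ is divisible by xⁱ; the derivative formula reduces coefficient n + 1 to coefficients
-- n that already vanish.
U-vanish : ∀ n i → n < i → U i n ≡ 0ℤ
U-vanish zero    (suc i) _         = trans (+-identityˡ _) (*-zeroˡ (U i 0))
U-vanish (suc n) (suc i) (s≤s n<i)
  rewrite U-derivative i n | U-vanish n i n<i | U-vanish n (suc i) (ℕ.m<n⇒m<1+n n<i) = *-zeroʳ (+ suc i)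

-- Coefficient n + 1 of a series is coefficient n of its derivative. Differentiating Σ g(i + 1) uⁱ
-- and regrouping by powers of u replaces g by `𝓓 g`, which is why g is arbitrary here.
Σ-U : ∀ n g → Σℤ (suc n) (λ i → g (+ suc i) * U i n) ≡ 𝓓^ n g 1ℤ
Σ-U zero    g = trans (+-identityˡ _) (*-identityʳ (g 1ℤ))
Σ-U (suc n) g = begin
  Σℤ (suc (suc n)) (λ i → g (+ suc i) * U i (suc n))
    ≡⟨ Σ-head-zero (suc n) _ (*-zeroʳ (g 1ℤ)) ⟩
  Σℤ (suc n) (λ i → g (+ suc (suc i)) * U (suc i) (suc n))
    ≡⟨ trans (Σ-cong′ (suc n) expand) (Σ-- (suc n) up (λ i → low (suc i))) ⟩
  Σℤ (suc n) up - Σℤ (suc n) (λ i → low (suc i))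
    -- Reindexing costs nothing: `low` vanishes at 0 by its factor i, and at n + 1 because uⁿ⁺¹ has
    -- no coefficient of order n.
    ≡⟨ cong (_-_ (Σℤ (suc n) up)) (trans (sym (Σ-head-zero (suc n) low first)) (Σ-last-zero (suc n) low last)) ⟩
  Σℤ (suc n) up - Σℤ (suc n) low
    ≡⟨ Σ-- (suc n) up low ⟨
  Σℤ (suc n) (λ i → up i - low i)
    ≡⟨ Σ-cong′ (suc n) (λ i → factor (+ suc i * g (+ suc (suc i))) (+ i * g (+ suc i)) (U i n)) ⟩
  Σℤ (suc n) (λ i → 𝓓 g (+ suc i) * U i n)
    ≡⟨ Σ-U n (𝓓 g) ⟩
  𝓓^ (suc n) g 1ℤ ∎
  where
  open ≡-Reasoning
  up low : ℕ → ℤ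
  up  i = + suc i * g (+ suc (suc i)) * U i n
  low i = + i * g (+ suc i) * U i n
  distr : ∀ g s a b → g * (s * (a - b)) ≡ s * g * a - s * g * b
  distr = solve-∀
  factor : ∀ a b c → a * c - b * c ≡ (a - b) * c
  factor = solve-∀
  expand : ∀ i → g (+ suc (suc i)) * U (suc i) (suc n) ≡ up i - low (suc i)
  expand i = trans (cong (g (+ suc (suc i)) *_) (U-derivative i n))
                   (distr (g (+ suc (suc i))) (+ suc i) (U i n) (U (suc i) n))
  first : low 0 ≡ 0ℤ
  first = trans (cong (_* U 0 n) (*-zeroˡ (g 1ℤ))) (*-zeroˡ (U 0 n))
  last : low (suc n) ≡ 0ℤ
  last rewrite U-vanish n (suc n) ℕ.≤-refl = *-zeroʳ (+ suc n * g (+ suc (suc n)))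

polyBernoulli-𝓓 : ∀ n k → polyBernoulli n k ≡ 𝓓^ n (_^ k) 1ℤ
polyBernoulli-𝓓 n k = Σ-U n (_^ k)

Unique-resp-↭ : ∀ {xs ys : List X} → xs ↭ ys → Unique xs → Unique ys
Unique-resp-↭ p = Setoid↭.Unique-resp-↭ (setoid _) (↭⇒↭ₛ p)

-- Sums over lists

∑ : List X → (X → ℤ) → ℤ
∑ []       f = 0ℤ
∑ (x ∷ xs) f = f x + ∑ xs f

∑-cong : ∀ (xs : List X) {f g : X → ℤ} → (∀ {x} → x ∈ xs → f x ≡ g x) → ∑ xs f ≡ ∑ xs g
∑-cong []       e = refl
∑-cong (x ∷ xs) e = cong₂ _+_ (e (here refl)) (∑-cong xs (e ∘ there))

∑-zero : ∀ (xs : List X) → ∑ xs (λ _ → 0ℤ) ≡ 0ℤ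
∑-zero []       = refl
∑-zero (x ∷ xs) = trans (+-identityˡ _) (∑-zero xs)

∑-++ : ∀ (xs ys : List X) f → ∑ (xs ++ ys) f ≡ ∑ xs f + ∑ ys f
∑-++ []       ys f = sym (+-identityˡ _)
∑-++ (x ∷ xs) ys f = trans (cong (_+_ (f x)) (∑-++ xs ys f)) (sym (+-assoc (f x) _ _))

∑-map : ∀ (h : X → Y) xs f → ∑ (map h xs) f ≡ ∑ xs (f ∘ h)
∑-map h []       f = refl
∑-map h (x ∷ xs) f = cong (_+_ (f (h x))) (∑-map h xs f)

∑-concatMap : ∀ (h : X → List Y) xs f → ∑ (concatMap h xs) f ≡ ∑ xs (λ x → ∑ (h x) f)
∑-concatMap h []       f = refl
∑-concatMap h (x ∷ xs) f =
  trans (∑-++ (h x) (concatMap h xs) f) (cong (_+_ (∑ (h x) f)) (∑-concatMap h xs f))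

∑-↭ : ∀ {xs ys : List X} f → xs ↭ ys → ∑ xs f ≡ ∑ ys f
∑-↭ f _↭_.refl          = refl
∑-↭ f (prep x p)        = cong (_+_ (f x)) (∑-↭ f p)
∑-↭ f (swap {xs} {ys} x y p) =
  trans (cong (λ s → f x + (f y + s)) (∑-↭ f p)) (exchange (f x) (f y) (∑ ys f))
  where
  exchange : ∀ a b c → a + (b + c) ≡ b + (a + c)
  exchange = solve-∀
∑-↭ f (_↭_.trans p q)   = trans (∑-↭ f p) (∑-↭ f q)

indicator : Bool → ℤ
indicator b = if b then 1ℤ else 0ℤ

length-filterᵇ : ∀ (p : X → Bool) xs → + length (filterᵇ p xs) ≡ ∑ xs (indicator ∘ p)
length-filterᵇ p []       = refl
length-filterᵇ p (x ∷ xs) with p x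
... | true  = cong (_+_ 1ℤ) (length-filterᵇ p xs)
... | false = trans (length-filterᵇ p xs) (sym (+-identityˡ _))

Σ-indicator : ∀ m c (h : ℕ → ℤ) → c < m → Σℤ m (λ j → indicator (c ≡ᵇ j) * h j) ≡ h c
Σ-indicator (suc m) zero h _ = begin
  Σℤ (suc m) (λ j → indicator (0 ≡ᵇ j) * h j)
    ≡⟨ Σ-head m _ ⟩
  1ℤ * h 0 + Σℤ m (λ j → 0ℤ * h (suc j))
    ≡⟨ cong₂ _+_ (*-identityˡ (h 0)) (Σ-zero m (λ j → *-zeroˡ (h (suc j)))) ⟩
  h 0 + 0ℤ
    ≡⟨ +-identityʳ (h 0) ⟩
  h 0 ∎
  where open ≡-Reasoning
Σ-indicator (suc m) (suc c) h (s≤s c<m) = begin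
  Σℤ (suc m) (λ j → indicator (suc c ≡ᵇ j) * h j)
    ≡⟨ Σ-head m _ ⟩
  0ℤ * h 0 + Σℤ m (λ j → indicator (c ≡ᵇ j) * h (suc j))
    ≡⟨ cong₂ _+_ (*-zeroˡ (h 0)) (Σ-indicator m c (h ∘ suc) c<m) ⟩
  0ℤ + h (suc c)
    ≡⟨ +-identityˡ (h (suc c)) ⟩
  h (suc c) ∎
  where open ≡-Reasoning

-- Exchanging the two summations leaves one nonzero index j for each x. This turns the Eulerian
-- numbers into a sum over permutations.
Σ-by-value : ∀ m (r : X → ℕ) (h : ℕ → ℤ) xs → (∀ {x} → x ∈ xs → r x < m) →
  Σℤ m (λ j → + length (filterᵇ (λ x → r x ≡ᵇ j) xs) * h j) ≡ ∑ xs (h ∘ r)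
Σ-by-value m r h []       _ = Σ-zero m (λ j → *-zeroˡ (h j))
Σ-by-value m r h (x ∷ xs) b = begin
  Σℤ m (λ j → + length (filterᵇ (λ y → r y ≡ᵇ j) (x ∷ xs)) * h j)
    ≡⟨ Σ-cong′ m (λ j → trans (cong (_* h j) (split j)) (*-distribʳ-+ (h j) (indicator (r x ≡ᵇ j)) _)) ⟩
  Σℤ m (λ j → indicator (r x ≡ᵇ j) * h j + + length (filterᵇ (λ y → r y ≡ᵇ j) xs) * h j)
    ≡⟨ Σ-+ m _ _ ⟩
  Σℤ m (λ j → indicator (r x ≡ᵇ j) * h j) + Σℤ m (λ j → + length (filterᵇ (λ y → r y ≡ᵇ j) xs) * h j)
    ≡⟨ cong₂ _+_ (Σ-indicator m (r x) h (b (here refl))) (Σ-by-value m r h xs (b ∘ there)) ⟩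
  h (r x) + ∑ xs (h ∘ r) ∎
  where
  open ≡-Reasoning
  split : ∀ j → + length (filterᵇ (λ y → r y ≡ᵇ j) (x ∷ xs)) ≡
                indicator (r x ≡ᵇ j) + + length (filterᵇ (λ y → r y ≡ᵇ j) xs)
  split j with r x ≡ᵇ j
  ... | true  = refl
  ... | false = sym (+-identityˡ _)

-- Permutations as successive insertions

insertions : X → List X → List (List X)
insertions x []       = (x ∷ []) ∷ []
insertions x (y ∷ ys) = (x ∷ y ∷ ys) ∷ map (y ∷_) (insertions x ys)

-- The head is inserted last, so a decreasing list inserts every letter as a new maximum.
insertionPerms : List X → List (List X)
insertionPerms []       = [] ∷ []
insertionPerms (x ∷ xs) = concatMap (insertions x) (insertionPerms xs)

∈-insertions⁺ : ∀ {x : X} us {vs} → us ++ x ∷ vs ∈ insertions x (us ++ vs)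
∈-insertions⁺ []       {[]}    = here refl
∈-insertions⁺ []       {_ ∷ _} = here refl
∈-insertions⁺ (u ∷ us)         = there (∈-map⁺ (u ∷_) (∈-insertions⁺ us))

insertions-↭ : ∀ {x : X} w {v} → v ∈ insertions x w → v ↭ x ∷ w
insertions-↭ []      (here refl) = ↭-refl
insertions-↭ (y ∷ w) (here refl) = ↭-refl
insertions-↭ (y ∷ w) (there v∈) with ∈-map⁻ (y ∷_) v∈
... | v′ , v′∈ , refl = ↭-trans (prep y (insertions-↭ w v′∈)) (swap y _ ↭-refl)

insertions-unique : ∀ {x : X} w → x ∉ w → Unique (insertions x w)
insertions-unique []      _   = [] ∷ []
insertions-unique {x = x} (y ∷ w) x∉w =
  All.tabulate head-new ∷ Unique.map⁺ ∷-injectiveʳ (insertions-unique w (x∉w ∘ there))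
  where
  head-new : ∀ {v} → v ∈ map (y ∷_) (insertions x w) → x ∷ y ∷ w ≢ v
  head-new v∈ refl with ∈-map⁻ (y ∷_) v∈
  ... | _ , _ , eq = x∉w (here (∷-injectiveˡ eq))

-- Deleting `x` recovers the original word. In the mixed cases `x` would have to be the head of a
-- word that avoids it.
insertions-injective : ∀ {x : X} w w′ {v} → x ∉ w → x ∉ w′ →
  v ∈ insertions x w → v ∈ insertions x w′ → w ≡ w′
insertions-injective []      []       _ _ _ _ = refl
insertions-injective []      (y ∷ w′) _ x∉w′ (here refl) (there v∈) with ∈-map⁻ (y ∷_) v∈
... | _ , _ , eq = contradiction (here (∷-injectiveˡ eq)) x∉w′
insertions-injective (y ∷ w) []       x∉w _ (there v∈) (here refl) with ∈-map⁻ (y ∷_) v∈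
... | _ , _ , eq = contradiction (here (∷-injectiveˡ eq)) x∉w
insertions-injective (y ∷ w) (z ∷ w′) _ _ (here refl) (here refl) = refl
insertions-injective (y ∷ w) (z ∷ w′) _ x∉w′ (here refl) (there v∈) with ∈-map⁻ (z ∷_) v∈
... | _ , _ , eq = contradiction (here (∷-injectiveˡ eq)) x∉w′
insertions-injective (y ∷ w) (z ∷ w′) x∉w _ (there v∈) (here refl) with ∈-map⁻ (y ∷_) v∈
... | _ , _ , eq = contradiction (here (∷-injectiveˡ eq)) x∉w
insertions-injective (y ∷ w) (z ∷ w′) x∉w x∉w′ (there v∈) (there v∈′)
  with ∈-map⁻ (y ∷_) v∈ | ∈-map⁻ (z ∷_) v∈′
... | _ , u∈ , refl | _ , u∈′ , refl =
  cong (y ∷_) (insertions-injective w w′ (x∉w ∘ there) (x∉w′ ∘ there) u∈ u∈′)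

concatMap-unique : ∀ (f : X → List Y) {xs} → Unique xs →
  (∀ {x} → x ∈ xs → Unique (f x)) →
  (∀ {x y v} → x ∈ xs → y ∈ xs → v ∈ f x → v ∈ f y → x ≡ y) →
  Unique (concatMap f xs)
concatMap-unique f []          _    _   = []
concatMap-unique f {x ∷ xs} x∷xs!@(_ ∷ xs!) each inj =
  Unique.++⁺ (each (here refl))
             (concatMap-unique f xs! (each ∘ there) (λ a b → inj (there a) (there b)))
             (λ { (v∈fx , v∈rest) →
                let y , y∈xs , v∈fy = find (∈-concatMap⁻ f v∈rest)
                in Unique[x∷xs]⇒x∉xs x∷xs! (subst (_∈ xs) (sym (inj (here refl) (there y∈xs) v∈fx v∈fy)) y∈xs) })

∈-insertionPerms⁻ : ∀ (as : List X) {w} → w ∈ insertionPerms as → w ↭ as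
∈-insertionPerms⁻ []       (here refl) = ↭-refl
∈-insertionPerms⁻ (a ∷ as) w∈ =
  let w′ , w′∈ , w∈ins = find (∈-concatMap⁻ (insertions a) w∈)
  in ↭-trans (insertions-↭ w′ w∈ins) (prep a (∈-insertionPerms⁻ as w′∈))

∈-insertionPerms⁺ : ∀ (as : List X) {w} → w ↭ as → w ∈ insertionPerms as
∈-insertionPerms⁺ []       p = here (↭-empty-inv p)
∈-insertionPerms⁺ (a ∷ as) p with ∈-∃++ (∈-resp-↭ (↭-sym p) (here refl))
... | us , vs , refl = ∈-concatMap⁺ (insertions a)
  (lose (∈-insertionPerms⁺ as (drop-mid us [] p)) (∈-insertions⁺ us))

∉-insertionPerms : ∀ {a : X} {as w} → Unique (a ∷ as) → w ∈ insertionPerms as → a ∉ w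
∉-insertionPerms {as = as} a∷as! w∈ a∈w =
  Unique[x∷xs]⇒x∉xs a∷as! (∈-resp-↭ (∈-insertionPerms⁻ as w∈) a∈w)

insertionPerms-unique : ∀ {as : List X} → Unique as → Unique (insertionPerms as)
insertionPerms-unique []               = [] ∷ []
insertionPerms-unique {as = a ∷ as} a∷as!@(_ ∷ as!) =
  concatMap-unique (insertions a) (insertionPerms-unique as!)
    (λ w∈ → insertions-unique _ (∉-insertionPerms a∷as! w∈))
    (λ w∈ w′∈ → insertions-injective _ _ (∉-insertionPerms a∷as! w∈) (∉-insertionPerms a∷as! w′∈))

-- Filtered words and insertions list the same permutations.

∈-words⁻ : ∀ l as {w} → w ∈ words l as → length w ≡ l × All (_∈ as) w
∈-words⁻ zero    as (here refl) = refl , []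
∈-words⁻ (suc l) as w∈ with find (∈-concatMap⁻ (λ a → map (a ∷_) (words l as)) {xs = as} w∈)
... | a , a∈ , w∈map with ∈-map⁻ (a ∷_) w∈map
... | w′ , w′∈ , refl = let len , all∈ = ∈-words⁻ l as w′∈ in cong suc len , a∈ ∷ all∈

∈-words⁺ : ∀ as {w} → All (_∈ as) w → w ∈ words (length w) as
∈-words⁺ as []         = here refl
∈-words⁺ as (_∷_ {x} {w} x∈ w⊆) =
  ∈-concatMap⁺ (λ a → map (a ∷_) (words (length w) as)) (lose x∈ (∈-map⁺ (x ∷_) (∈-words⁺ as w⊆)))

words-unique : ∀ l {as} → Unique as → Unique (words l as)
words-unique zero    _   = [] ∷ []
words-unique (suc l) {as} as! =
  concatMap-unique (λ a → map (a ∷_) (words l as)) as!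
    (λ _ → Unique.map⁺ ∷-injectiveʳ (words-unique l as!))
    (λ {x} {y} _ _ v∈ v∈′ → same x y (∈-map⁻ (x ∷_) v∈) (∈-map⁻ (y ∷_) v∈′))
  where
  same : ∀ x y {v} → ∃ (λ w → w ∈ words l as × v ≡ x ∷ w) → ∃ (λ w → w ∈ words l as × v ≡ y ∷ w) → x ≡ y
  same x y (_ , _ , eq) (_ , _ , eq′) = ∷-injectiveˡ (trans (sym eq) eq′)

T-not⇒¬T : ∀ {b} → T (not b) → ¬ T b
T-not⇒¬T {false} _ ()

¬T⇒T-not : ∀ {b} → ¬ T b → T (not b)
¬T⇒T-not {false} _  = _
¬T⇒T-not {true}  ¬t = ¬t _

any-≡ᵇ⇔∈ : ∀ x w → T (any (x ≡ᵇ_) w) ⇔ x ∈ w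
any-≡ᵇ⇔∈ x w = mk⇔ (Any.map (ℕ.≡ᵇ⇒≡ x _) ∘ any⁻ (x ≡ᵇ_) w) (any⁺ (x ≡ᵇ_) ∘ Any.map (ℕ.≡⇒≡ᵇ x _))

distinct⁻ : ∀ w → T (distinct w) → Unique w
distinct⁻ []      _ = []
distinct⁻ (x ∷ w) d with Equivalence.to (T-∧ {not (any (x ≡ᵇ_) w)}) d
... | x∉ , w! =
  All.tabulate (λ { y∈ refl → T-not⇒¬T x∉ (Equivalence.from (any-≡ᵇ⇔∈ x w) y∈) }) ∷ distinct⁻ w w!

distinct⁺ : ∀ {w} → Unique w → T (distinct w)
distinct⁺ []        = _
distinct⁺ {x ∷ w} x∷w!@(_ ∷ w!) = Equivalence.from T-∧
  (¬T⇒T-not (Unique[x∷xs]⇒x∉xs x∷w! ∘ Equivalence.to (any-≡ᵇ⇔∈ x w)) , distinct⁺ w!)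

-- A pigeonhole argument: the head of `w` is removed from `as`, and by uniqueness the tail of `w`
-- lies in what remains.
unique-⊆-length⇒↭ : ∀ {w as : List X} → Unique w → All (_∈ as) w → length w ≡ length as → w ↭ as
unique-⊆-length⇒↭ {as = []} [] [] _ = ↭-refl
unique-⊆-length⇒↭ {w = x ∷ w} x∷w!@(_ ∷ w!) (x∈ ∷ w⊆) len with ∈-∃++ x∈
... | us , vs , refl = ↭-trans (prep x w↭) (↭-sym (shift x us vs))
  where
  drop : ∀ {y} → y ∈ w → y ∈ us ++ x ∷ vs → y ∈ us ++ vs
  drop y∈w y∈ with ∈-++⁻ us y∈
  ... | inj₁ y∈us         = ∈-++⁺ˡ y∈us
  ... | inj₂ (here refl)  = contradiction y∈w (Unique[x∷xs]⇒x∉xs x∷w!)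
  ... | inj₂ (there y∈vs) = ∈-++⁺ʳ us y∈vs
  w↭ : w ↭ us ++ vs
  w↭ = unique-⊆-length⇒↭ w! (All.tabulate (λ y∈ → drop y∈ (All.lookup w⊆ y∈)))
         (ℕ.suc-injective (trans len (↭-length (shift x us vs))))

range1-unique : ∀ N → Unique (range1 N)
range1-unique N = Unique.applyUpTo⁺₁ suc N (λ i<j _ eq → ℕ.<⇒≢ i<j (ℕ.suc-injective eq))

length-range1 : ∀ N → length (range1 N) ≡ N
length-range1 = length-applyUpTo suc

∈-perms⁻ : ∀ N {w} → w ∈ perms N → w ↭ range1 N
∈-perms⁻ N w∈ with ∈-filter⁻ (T? ∘ distinct) {xs = words N (range1 N)} w∈
... | w∈words , d with ∈-words⁻ N (range1 N) w∈words
... | len , w⊆ = unique-⊆-length⇒↭ (distinct⁻ _ d) w⊆ (trans len (sym (length-range1 N)))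

∈-perms⁺ : ∀ N {w} → w ↭ range1 N → w ∈ perms N
∈-perms⁺ N {w} p = ∈-filter⁺ (T? ∘ distinct)
  (subst (λ l → w ∈ words l (range1 N)) (trans (↭-length p) (length-range1 N))
    (∈-words⁺ (range1 N) (All.tabulate (∈-resp-↭ p))))
  (distinct⁺ (Unique-resp-↭ (↭-sym p) (range1-unique N)))

perms-unique : ∀ N → Unique (perms N)
perms-unique N = Unique.filter⁺ (T? ∘ distinct) (words-unique N (range1-unique N))

-- Duplicate-free lists with the same members agree as bags. The order `as` of insertion stays free,
-- to be chosen for each count.
perms-↭-insertionPerms : ∀ {N as} → as ↭ range1 N → perms N ↭ insertionPerms as
perms-↭-insertionPerms {N} {as} as↭ =
  ∼bag⇒↭ (unique∧set⇒bag (perms-unique N)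
    (insertionPerms-unique (Unique-resp-↭ (↭-sym as↭) (range1-unique N)))
    (mk⇔ (λ w∈ → ∈-insertionPerms⁺ as (↭-trans (∈-perms⁻ N w∈) (↭-sym as↭)))
         (λ w∈ → ∈-perms⁺ N (↭-trans (∈-insertionPerms⁻ as w∈) as↭))))

T⇒≡true : ∀ {b} → T b → b ≡ true
T⇒≡true = Equivalence.to T-≡

¬T⇒≡false : ∀ {b} → ¬ T b → b ≡ false
¬T⇒≡false {false} _  = refl
¬T⇒≡false {true}  ¬t = contradiction _ ¬t

<⇒<ᵇ≡true : ∀ {m n} → m < n → (m <ᵇ n) ≡ true
<⇒<ᵇ≡true = T⇒≡true ∘ ℕ.<⇒<ᵇ

≤⇒<ᵇ≡false : ∀ {m n} → n ≤ m → (m <ᵇ n) ≡ false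
≤⇒<ᵇ≡false {m} {n} n≤m = ¬T⇒≡false (ℕ.≤⇒≯ n≤m ∘ ℕ.<ᵇ⇒< m n)

≤⇒≤ᵇ≡true : ∀ {m n} → m ≤ n → (m ≤ᵇ n) ≡ true
≤⇒≤ᵇ≡true = T⇒≡true ∘ ℕ.≤⇒≤ᵇ

>⇒≤ᵇ≡false : ∀ {m n} → m > n → (m ≤ᵇ n) ≡ false
>⇒≤ᵇ≡false {m} {n} m>n = ¬T⇒≡false (ℕ.<⇒≱ m>n ∘ ℕ.≤ᵇ⇒≤ m n)

-- Eulerian numbers

-- Keeping the first letter `y` fixed makes the induction go through: the new maximum preserves the
-- descents when it enters a descent or goes to the end, and adds one elsewhere.
∑-insert-after : ∀ {x} (G : ℕ → ℤ) y ys → All (_< x) (y ∷ ys) →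
  ∑ (insertions x ys) (λ w → G (descents (y ∷ w))) ≡
  + suc (descents (y ∷ ys)) * G (descents (y ∷ ys)) +
  (+ length ys - + descents (y ∷ ys)) * G (suc (descents (y ∷ ys)))
∑-insert-after {x} G y [] (y<x ∷ []) rewrite ≤⇒<ᵇ≡false (ℕ.<⇒≤ y<x) = ring (G 0) (G 1)
  where
  ring : ∀ a b → a + 0ℤ ≡ 1ℤ * a + (0ℤ - 0ℤ) * b
  ring = solve-∀
∑-insert-after {x} G y (z ∷ zs) (y<x ∷ z<x ∷ zs<x)
  rewrite ≤⇒<ᵇ≡false (ℕ.<⇒≤ y<x) | <⇒<ᵇ≡true z<x
        | ∑-map (z ∷_) (insertions x zs) (λ w → G (descents (y ∷ w)))
  with z <ᵇ y
... | false = trans (cong (_+_ (G (suc d))) (∑-insert-after G z zs (z<x ∷ zs<x)))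
                    (ring (+ d) (+ length zs) (G d) (G (suc d)))
  where
  d = descents (z ∷ zs)
  ring : ∀ d l a b → b + ((1ℤ + d) * a + (l - d) * b) ≡ (1ℤ + d) * a + (1ℤ + l - d) * b
  ring = solve-∀
-- Between y and z the maximum merely replaces a descent; in all further positions that descent
-- survives, hence `G ∘ suc`.
... | true  = trans (cong (_+_ (G (suc d))) (∑-insert-after (G ∘ suc) z zs (z<x ∷ zs<x)))
                    (ring (+ d) (+ length zs) (G (suc d)) (G (suc (suc d))))
  where
  d = descents (z ∷ zs)
  ring : ∀ d l a b → a + ((1ℤ + d) * a + (l - d) * b) ≡ (1ℤ + (1ℤ + d)) * a + (1ℤ + l - (1ℤ + d)) * b
  ring = solve-∀

∑-insert-max : ∀ {x} (G : ℕ → ℤ) w → All (_< x) w →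
  ∑ (insertions x w) (G ∘ descents) ≡
  + suc (descents w) * G (descents w) + (+ length w - + descents w) * G (suc (descents w))
∑-insert-max G [] [] = ring (G 0) (G 1)
  where
  ring : ∀ a b → a + 0ℤ ≡ 1ℤ * a + (0ℤ - 0ℤ) * b
  ring = solve-∀
∑-insert-max {x} G (y ∷ ys) y<x∷ys<x@(y<x ∷ _)
  rewrite <⇒<ᵇ≡true y<x | ∑-map (y ∷_) (insertions x ys) (G ∘ descents) =
  trans (cong (_+_ (G (suc d))) (∑-insert-after G y ys y<x∷ys<x))
        (ring (+ d) (+ length ys) (G d) (G (suc d)))
  where
  d = descents (y ∷ ys)
  ring : ∀ d l a b → b + ((1ℤ + d) * a + (l - d) * b) ≡ (1ℤ + d) * a + (1ℤ + l - d) * b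
  ring = solve-∀

∑-descents : ∀ {as} (G : ℕ → ℤ) → AllPairs _>_ as →
  ∑ (insertionPerms as) (G ∘ descents) ≡ insertionSum (length as) G
∑-descents G [] = +-identityʳ (G 0)
∑-descents {a ∷ as} G (a> ∷ as>) = begin
  ∑ (insertionPerms (a ∷ as)) (G ∘ descents)
    ≡⟨ ∑-concatMap (insertions a) (insertionPerms as) _ ⟩
  ∑ (insertionPerms as) (λ w → ∑ (insertions a w) (G ∘ descents))
    ≡⟨ ∑-cong (insertionPerms as) insert ⟩
  ∑ (insertionPerms as) ((λ d → + suc d * G d + (+ length as - + d) * G (suc d)) ∘ descents)
    ≡⟨ ∑-descents _ as> ⟩
  insertionSum (suc (length as)) G ∎
  where
  open ≡-Reasoning
  insert : ∀ {w} → w ∈ insertionPerms as → ∑ (insertions a w) (G ∘ descents) ≡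
    + suc (descents w) * G (descents w) + (+ length as - + descents w) * G (suc (descents w))
  insert {w} w∈ = trans (∑-insert-max G w (All-resp-↭ (↭-sym p) a>))
    (cong (λ l → + suc (descents w) * G (descents w) + (+ l - + descents w) * G (suc (descents w))) (↭-length p))
    where p = ∈-insertionPerms⁻ as w∈

-- The decreasing list a + m, ..., a + 1.
letters : ℕ → ℕ → List ℕ
letters a m = applyDownFrom (λ i → suc (a ℕ.+ i)) m

letters-decreasing : ∀ a m → AllPairs _>_ (letters a m)
letters-decreasing a m = AllPairs.applyDownFrom⁺₁ _ m (λ j<i _ → s≤s (ℕ.+-monoʳ-< a j<i))

letters-↭-range1 : ∀ m → letters 0 m ↭ range1 m
letters-↭-range1 m = ↭-trans (↭-reflexive (sym (reverse-applyUpTo suc m))) (↭-reverse (range1 m))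

letters-++ : ∀ n k → letters n k ++ letters 0 n ≡ letters 0 (n ℕ.+ k)
letters-++ n zero    = cong (letters 0) (sym (ℕ.+-identityʳ n))
letters-++ n (suc k) = trans (cong (suc (n ℕ.+ k) ∷_) (letters-++ n k)) (cong (letters 0) (sym (ℕ.+-suc n k)))

descents-bound : ∀ x w → descents (x ∷ w) ≤ length w
descents-bound x []      = z≤n
descents-bound x (y ∷ w) with y <ᵇ x
... | true  = s≤s (descents-bound y w)
... | false = ℕ.m≤n⇒m≤1+n (descents-bound y w)

runs-bound : ∀ w → runs w ≤ length w
runs-bound []      = z≤n
runs-bound (x ∷ w) = s≤s (descents-bound x w)

-- The number of runs is `suc d` for d descents, so the upper binomial index j - 1 is the order d.
innerSum-∇ : ∀ n k d → innerSum n k (suc d) ≡ ∇ d (_^ n) (+ suc k)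
innerSum-∇ n k d = ∇-expand d (_^ n) (+ suc k)

eulerSum-insertionSum : ∀ n k → 0 < k →
  eulerSum n k ≡ insertionSum k (λ d → ∇ d (_^ n) (+ suc k))
eulerSum-insertionSum n k 0<k = begin
  eulerSum n k
    ≡⟨ Σ-by-value (suc k) runs (innerSum n k) (perms k) (λ {w} w∈ → s≤s (subst (runs w ≤_) (len w∈) (runs-bound w))) ⟩
  ∑ (perms k) (innerSum n k ∘ runs)
    -- As k is positive, no word here is empty. Only the empty word fails to have one more run than
    -- descents.
    ≡⟨ ∑-cong (perms k) (λ {w} w∈ → inner w (subst (0 <_) (sym (len w∈)) 0<k)) ⟩
  ∑ (perms k) (G ∘ descents)
    ≡⟨ ∑-↭ _ (perms-↭-insertionPerms (letters-↭-range1 k)) ⟩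
  ∑ (insertionPerms (letters 0 k)) (G ∘ descents)
    ≡⟨ ∑-descents G (letters-decreasing 0 k) ⟩
  insertionSum (length (letters 0 k)) G
    ≡⟨ cong (λ l → insertionSum l G) (length-applyDownFrom _ k) ⟩
  insertionSum k G ∎
  where
  open ≡-Reasoning
  G : ℕ → ℤ
  G d = ∇ d (_^ n) (+ suc k)
  len : ∀ {w} → w ∈ perms k → length w ≡ k
  len w∈ = trans (↭-length (∈-perms⁻ k w∈)) (length-range1 k)
  inner : ∀ w → 0 < length w → innerSum n k (runs w) ≡ G (descents w)
  inner (x ∷ w) _ = innerSum-∇ n k (descents (x ∷ w))

-- Callan permutations

-- The two bad kinds differ in their future: a letter of N inserted later can fill a descent in K,
-- whereas a larger letter of N placed inside a descent in N creates another one.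
data Adjacency : Set where
  fine N-descent K-descent : Adjacency

classify : (descent left∈N right∈N : Bool) → Adjacency
classify true  true  true  = N-descent
classify true  false false = K-descent
classify _     _     _     = fine

adjacency : ℕ → ℕ → ℕ → Adjacency
adjacency n x y = classify (y <ᵇ x) (x ≤ᵇ n) (y ≤ᵇ n)

apply : Adjacency → (ℕ → ℤ) → ((ℕ → ℤ) → ℤ) → ℤ
apply fine      G k = k G
apply N-descent G k = 0ℤ
apply K-descent G k = k (G ∘ suc)

-- 0 if some descent joins two letters of N, and G evaluated at the number
-- of descents joining two letters of K otherwise.
weight : ℕ → (ℕ → ℤ) → List ℕ → ℤ
weight n G []          = G 0
weight n G (x ∷ [])    = G 0
weight n G (x ∷ y ∷ w) = apply (adjacency n x y) G (λ H → weight n H (y ∷ w))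

weight-cong : ∀ n {G H : ℕ → ℤ} w → (∀ d → G d ≡ H d) → weight n G w ≡ weight n H w
weight-cong n []          e = e 0
weight-cong n (x ∷ [])    e = e 0
weight-cong n (x ∷ y ∷ w) e
  with adjacency n x y | weight-cong n (y ∷ w) e | weight-cong n (y ∷ w) (e ∘ suc)
... | fine      | ih | _  = ih
... | N-descent | _  | _  = refl
... | K-descent | _  | ih = ih

weight-+ : ∀ n (G H : ℕ → ℤ) w → weight n G w + weight n H w ≡ weight n (λ d → G d + H d) w
weight-+ n G H []          = refl
weight-+ n G H (x ∷ [])    = refl
weight-+ n G H (x ∷ y ∷ w)
  with adjacency n x y | weight-+ n G H (y ∷ w) | weight-+ n (G ∘ suc) (H ∘ suc) (y ∷ w)
... | fine      | ih | _  = ih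
... | N-descent | _  | _  = refl
... | K-descent | _  | ih = ih

weight-zero : ∀ n {G : ℕ → ℤ} w → (∀ d → G d ≡ 0ℤ) → weight n G w ≡ 0ℤ
weight-zero n []          e = e 0
weight-zero n (x ∷ [])    e = e 0
weight-zero n (x ∷ y ∷ w) e
  with adjacency n x y | weight-zero n (y ∷ w) e | weight-zero n (y ∷ w) (e ∘ suc)
... | fine      | ih | _  = ih
... | N-descent | _  | _  = refl
... | K-descent | _  | ih = ih

weight-K : ∀ {n} (G : ℕ → ℤ) w → All (n <_) w → weight n G w ≡ G (descents w)
weight-K G []          _                  = refl
weight-K G (x ∷ [])    _                  = refl
weight-K {n} G (x ∷ y ∷ w) (n<x ∷ n<y∷w@(n<y ∷ _))
  with x ≤ᵇ n | >⇒≤ᵇ≡false n<x | y ≤ᵇ n | >⇒≤ᵇ≡false n<y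
     | y <ᵇ x | weight-K G (y ∷ w) n<y∷w | weight-K (G ∘ suc) (y ∷ w) n<y∷w
... | _ | refl | _ | refl | false | ih | _  = ih
... | _ | refl | _ | refl | true  | _  | ih = ih

-- Inserting the largest letter of N: each of the c gaps between letters of K
-- has one admissible position, and d of these gaps are descents that it removes.
insertN : ℤ → (ℕ → ℤ) → ℕ → ℤ
insertN c G d = (c - + d) * G d + + d * G (pred d)

#K : ℕ → List ℕ → ℕ
#K n w = length (filter (n ℕ.<?_) w)

module _ {n x} (x≤n : x ≤ n) where

  -- The new letter `x` exceeds all letters of N present. It never conflicts with its left
  -- neighbour, and conflicts with its right neighbour only if that is in N.
  adjacency-new-right : ∀ y → (y ≤ n → y < x) → adjacency n y x ≡ fine
  adjacency-new-right y y<x with y ℕ.≤? n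
  ... | yes y≤n rewrite ≤⇒<ᵇ≡false (ℕ.<⇒≤ (y<x y≤n)) = refl
  ... | no  y≰n rewrite >⇒≤ᵇ≡false (ℕ.≰⇒> y≰n) | ≤⇒≤ᵇ≡true x≤n with x <ᵇ y
  ...   | true  = refl
  ...   | false = refl

  adjacency-new-left-N : ∀ {z} → z ≤ n → z < x → adjacency n x z ≡ N-descent
  adjacency-new-left-N z⊑n z<x rewrite <⇒<ᵇ≡true z<x | ≤⇒≤ᵇ≡true x≤n | ≤⇒≤ᵇ≡true z⊑n = refl

  adjacency-new-left-K : ∀ {z} → n < z → adjacency n x z ≡ fine
  adjacency-new-left-K n<z rewrite ≤⇒<ᵇ≡false (ℕ.<⇒≤ (ℕ.≤-<-trans x≤n n<z)) = refl

  insertN-suc : ∀ c G w → weight n G w + weight n (insertN c G) w ≡ weight n (insertN (1ℤ + c) G) w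
  insertN-suc c G w = trans (weight-+ n G (insertN c G) w)
    (weight-cong n w (λ d → ring c (+ d) (G d) (G (pred d))))
    where
    ring : ∀ c d a b → a + ((c - d) * a + d * b) ≡ (1ℤ + c - d) * a + d * b
    ring = solve-∀

  -- Filling the descent in front of `w` gives `G`; inserting further right leaves it in place,
  -- hence `G ∘ suc`. Together there is one more gap, and one more gap that is a descent.
  insertN-K-descent : ∀ c G w → weight n G w + weight n (insertN c (G ∘ suc)) w ≡
                                weight n (insertN (1ℤ + c) G ∘ suc) w
  insertN-K-descent c G w = trans (weight-+ n G (insertN c (G ∘ suc)) w) (weight-cong n w step)
    where
    ring₀ : ∀ c a b → a + ((c - 0ℤ) * b + 0ℤ * b) ≡ (1ℤ + c - 1ℤ) * b + 1ℤ * a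
    ring₀ = solve-∀
    ring₁ : ∀ c d a b → a + ((c - d) * b + d * a) ≡ (1ℤ + c - (1ℤ + d)) * b + (1ℤ + d) * a
    ring₁ = solve-∀
    step : ∀ d → G d + insertN c (G ∘ suc) d ≡ insertN (1ℤ + c) G (suc d)
    -- The case 0 is separate because `pred` does not lower it.
    step zero    = ring₀ c (G 0) (G 1)
    step (suc d) = ring₁ c (+ suc d) (G (suc d)) (G (suc (suc d)))

  -- After the fixed letter `y`, the admissible positions are the end and the place just before each
  -- letter of K, which accounts for `suc (#K n ys)`.
  ∑-insertN-after : ∀ G y ys → All (λ z → z ≤ n → z < x) (y ∷ ys) →
    ∑ (insertions x ys) (λ w → weight n G (y ∷ w)) ≡ weight n (insertN (+ suc (#K n ys)) G) (y ∷ ys)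
  ∑-insertN-after G y [] (y<x ∷ []) rewrite adjacency-new-right y y<x = ring (G 0)
    where
    ring : ∀ a → a + 0ℤ ≡ (1ℤ - 0ℤ) * a + 0ℤ * a
    ring = solve-∀
  ∑-insertN-after G y (z ∷ zs) (y<x ∷ z<x) = begin
    weight n G (y ∷ x ∷ z ∷ zs) + ∑ (map (z ∷_) (insertions x zs)) (λ w → weight n G (y ∷ w))
      ≡⟨ cong₂ _+_ (cong (λ a → apply a G (λ H → weight n H (x ∷ z ∷ zs))) (adjacency-new-right y y<x))
                   (∑-map (z ∷_) (insertions x zs) (λ w → weight n G (y ∷ w))) ⟩
    weight n G (x ∷ z ∷ zs) + ∑ (insertions x zs) (λ w → apply (adjacency n y z) G (λ H → weight n H (z ∷ w)))
      ≡⟨ next (z ℕ.≤? n) ⟩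
    weight n (insertN (+ suc (#K n (z ∷ zs))) G) (y ∷ z ∷ zs) ∎
    where
    open ≡-Reasoning
    c = #K n zs
    ih : ∀ H → ∑ (insertions x zs) (λ w → weight n H (z ∷ w)) ≡ weight n (insertN (+ suc c) H) (z ∷ zs)
    ih H = ∑-insertN-after H z zs z<x
    next : Dec (z ≤ n) →
      weight n G (x ∷ z ∷ zs) + ∑ (insertions x zs) (λ w → apply (adjacency n y z) G (λ H → weight n H (z ∷ w))) ≡
      weight n (insertN (+ suc (#K n (z ∷ zs))) G) (y ∷ z ∷ zs)
    -- Directly before a letter z of N the new letter creates an N-descent, so this position
    -- contributes 0.
    next (yes z⊑n)
      rewrite adjacency-new-left-N z⊑n (All.head z<x z⊑n)
            | filter-reject (n ℕ.<?_) {xs = zs} (ℕ.≤⇒≯ z⊑n)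
            | ≤⇒≤ᵇ≡true z⊑n
      with y <ᵇ z | z <ᵇ y | y ≤ᵇ n
    ... | _ | true  | true  = trans (+-identityˡ _) (∑-zero (insertions x zs))
    ... | _ | true  | false = trans (+-identityˡ _) (ih G)
    ... | _ | false | true  = trans (+-identityˡ _) (ih G)
    ... | _ | false | false = trans (+-identityˡ _) (ih G)
    -- Directly before a letter z of K the position is admissible, and it removes a K-descent
    -- exactly when y and z form one.
    next (no z≰n)
      rewrite adjacency-new-left-K (ℕ.≰⇒> z≰n)
            | filter-accept (n ℕ.<?_) {xs = zs} (ℕ.≰⇒> z≰n)
            | >⇒≤ᵇ≡false (ℕ.≰⇒> z≰n)
      with z <ᵇ y | y ≤ᵇ n
    ... | true  | true  = trans (cong (_+_ (weight n G (z ∷ zs))) (ih G)) (insertN-suc (+ suc c) G (z ∷ zs))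
    ... | true  | false = trans (cong (_+_ (weight n G (z ∷ zs))) (ih (G ∘ suc))) (insertN-K-descent (+ suc c) G (z ∷ zs))
    ... | false | true  = trans (cong (_+_ (weight n G (z ∷ zs))) (ih G)) (insertN-suc (+ suc c) G (z ∷ zs))
    ... | false | false = trans (cong (_+_ (weight n G (z ∷ zs))) (ih G)) (insertN-suc (+ suc c) G (z ∷ zs))

  -- Only the front position is added to `∑-insertN-after`; it is admissible exactly when the word
  -- starts in K.
  ∑-insertN : ∀ G w → All (λ z → z ≤ n → z < x) w →
    ∑ (insertions x w) (weight n G) ≡ weight n (insertN (+ suc (#K n w)) G) w
  ∑-insertN G [] [] = ring (G 0)
    where
    ring : ∀ a → a + 0ℤ ≡ (1ℤ - 0ℤ) * a + 0ℤ * a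
    ring = solve-∀
  ∑-insertN G (y ∷ ys) y∷ys<x@(y<x ∷ _) = begin
    weight n G (x ∷ y ∷ ys) + ∑ (map (y ∷_) (insertions x ys)) (weight n G)
      ≡⟨ cong (_+_ (weight n G (x ∷ y ∷ ys))) (trans (∑-map (y ∷_) (insertions x ys) _) (∑-insertN-after G y ys y∷ys<x)) ⟩
    weight n G (x ∷ y ∷ ys) + weight n (insertN (+ suc (#K n ys)) G) (y ∷ ys)
      ≡⟨ first (y ℕ.≤? n) ⟩
    weight n (insertN (+ suc (#K n (y ∷ ys))) G) (y ∷ ys) ∎
    where
    open ≡-Reasoning
    first : Dec (y ≤ n) →
      weight n G (x ∷ y ∷ ys) + weight n (insertN (+ suc (#K n ys)) G) (y ∷ ys) ≡
      weight n (insertN (+ suc (#K n (y ∷ ys))) G) (y ∷ ys)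
    first (yes y≤n)
      rewrite adjacency-new-left-N y≤n (y<x y≤n)
            | filter-reject (n ℕ.<?_) {xs = ys} (ℕ.≤⇒≯ y≤n) = +-identityˡ _
    first (no y≰n)
      rewrite adjacency-new-left-K (ℕ.≰⇒> y≰n)
            | filter-accept (n ℕ.<?_) {xs = ys} (ℕ.≰⇒> y≰n) = insertN-suc (+ suc (#K n ys)) G (y ∷ ys)

-- With c = k + 1, where k is the length of `ks`, `insertN` is the Leibniz rule `∇-id*`. Each letter
-- of N therefore raises the exponent by one, and a general initial exponent `r` lets the induction
-- absorb the letters.
∑-weight : ∀ {n ns ks} r → AllPairs _>_ ns → All (_≤ n) ns → All (n <_) ks →
  ∑ (insertionPerms (ns ++ ks)) (weight n (λ d → ∇ d (_^ r) (+ suc (length ks)))) ≡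
  ∑ (insertionPerms ks) (weight n (λ d → ∇ d (_^ (length ns ℕ.+ r)) (+ suc (length ks))))
∑-weight r [] [] ks>n = refl
∑-weight {n} {x ∷ ns} {ks} r (x>ns ∷ ns>) (x≤n ∷ ns≤n) ks>n = begin
  ∑ (insertionPerms (x ∷ ns ++ ks)) (weight n (F r))
    ≡⟨ ∑-concatMap (insertions x) (insertionPerms (ns ++ ks)) _ ⟩
  ∑ (insertionPerms (ns ++ ks)) (λ w → ∑ (insertions x w) (weight n (F r)))
    ≡⟨ ∑-cong (insertionPerms (ns ++ ks)) insert ⟩
  ∑ (insertionPerms (ns ++ ks)) (weight n (F (suc r)))
    ≡⟨ ∑-weight (suc r) ns> ns≤n ks>n ⟩
  ∑ (insertionPerms ks) (weight n (F (length ns ℕ.+ suc r)))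
    ≡⟨ cong (λ m → ∑ (insertionPerms ks) (weight n (F m))) (ℕ.+-suc (length ns) r) ⟩
  ∑ (insertionPerms ks) (weight n (F (suc (length ns ℕ.+ r)))) ∎
  where
  open ≡-Reasoning
  F : ℕ → ℕ → ℤ
  F r d = ∇ d (_^ r) (+ suc (length ks))
  #K≡ : ∀ {w} → w ↭ ns ++ ks → #K n w ≡ length ks
  #K≡ {w} p = begin
    length (filter (n ℕ.<?_) w)         ≡⟨ ↭-length (filter-↭ (n ℕ.<?_) p) ⟩
    length (filter (n ℕ.<?_) (ns ++ ks)) ≡⟨ cong length (filter-++ (n ℕ.<?_) ns ks) ⟩
    length (filter (n ℕ.<?_) ns ++ filter (n ℕ.<?_) ks)
      ≡⟨ cong₂ (λ us vs → length (us ++ vs)) (filter-none (n ℕ.<?_) (All.map ℕ.≤⇒≯ ns≤n)) (filter-all (n ℕ.<?_) ks>n) ⟩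
    length ks ∎
  insert : ∀ {w} → w ∈ insertionPerms (ns ++ ks) → ∑ (insertions x w) (weight n (F r)) ≡ weight n (F (suc r)) w
  insert {w} w∈ = begin
    ∑ (insertions x w) (weight n (F r))
      ≡⟨ ∑-insertN x≤n (F r) w (All-resp-↭ (↭-sym p) (All.++⁺ (All.map const x>ns) (All.map (λ n<z z⊑n → contradiction z⊑n (ℕ.<⇒≱ n<z)) ks>n))) ⟩
    weight n (insertN (+ suc (#K n w)) (F r)) w
      ≡⟨ cong (λ c → weight n (insertN (+ suc c) (F r)) w) (#K≡ p) ⟩
    weight n (insertN (+ suc (length ks)) (F r)) w
      ≡⟨ weight-cong n w (λ d → sym (∇-id* d (_^ r) (+ suc (length ks)))) ⟩
    weight n (F (suc r)) w ∎
    where p = ∈-insertionPerms⁻ (ns ++ ks) w∈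

-- The Callan condition as a condition on neighbouring letters.

Compatible : ℕ → ℕ → ℕ → Set
Compatible n x y = adjacency n x y ≡ fine

weight-linked : ∀ {n G w} → Linked (Compatible n) w → weight n G w ≡ G 0
weight-linked []          = refl
weight-linked [-]         = refl
weight-linked (fine≡ ∷ l) rewrite fine≡ = weight-linked l

-- A word that is not linked has an N-descent, of weight 0, or a K-descent, which shifts `G` into
-- the range where it vanishes.
weight-¬linked : ∀ {n G} w → (∀ d → G (suc d) ≡ 0ℤ) → ¬ Linked (Compatible n) w → weight n G w ≡ 0ℤ
weight-¬linked []          e ¬l = contradiction [] ¬l
weight-¬linked (x ∷ [])    e ¬l = contradiction [-] ¬l
weight-¬linked {n} (x ∷ y ∷ w) e ¬l with adjacency n x y in eq | weight-¬linked {n} (y ∷ w) e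
... | fine      | ih = ih (¬l ∘ (eq ∷_))
... | N-descent | _  = refl
... | K-descent | _  = weight-zero n (y ∷ w) e

∈-inits-linked : ∀ {R : ℕ → ℕ → Set} {w} → Linked R w → All (Linked R) (inits w)
∈-inits-linked []  = [] ∷ []
∈-inits-linked [-] = [] ∷ [-] ∷ []
∈-inits-linked (r ∷ l) with ∈-inits-linked l
... | _ ∷ ls = [] ∷ [-] ∷ All.map⁺ (All.map⁺ (All.map (r ∷_) (All.map⁻ ls)))

factors-linked : ∀ {R : ℕ → ℕ → Set} {w} → Linked R w → All (Linked R) (factors w)
factors-linked []      = [] ∷ []
factors-linked [-]     = [] ∷ [-] ∷ [] ∷ []
factors-linked (r ∷ l) = All.++⁺ (∈-inits-linked (r ∷ l)) (factors-linked l)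

increasing-linked : ∀ {w} → Linked _<_ w → T (increasing w)
increasing-linked []        = _
increasing-linked [-]       = _
increasing-linked (x<y ∷ l) = Equivalence.from T-∧ (ℕ.<⇒<ᵇ x<y , increasing-linked l)

-- The flag `b` tells whether all letters lie in N or all lie above n. Inside one class a `fine`
-- pair is not a descent, and distinctness makes the ascent strict.
linked-< : ∀ {n s} b → Linked (λ x y → Compatible n x y × x ≢ y) s → All (λ x → (x ≤ᵇ n) ≡ b) s → Linked _<_ s
linked-< b [] _ = []
linked-< b [-] _ = [-]
linked-< {n} b (_∷_ {x} {y} (ok , x≢y) l) (x≡b ∷ y≡b ∷ s≡b)
  rewrite x≡b | y≡b with b | y <ᵇ x in eq
... | b | false = ℕ.≤∧≢⇒< (ℕ.≮⇒≥ (λ y<x → subst T eq (ℕ.<⇒<ᵇ y<x))) x≢y ∷ linked-< b l (y≡b ∷ s≡b)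
... | true  | true = contradiction ok λ ()
... | false | true = contradiction ok λ ()

module _ (n k : ℕ) where

  callanFactor : List ℕ → Bool
  callanFactor s = if all (inN n) s then increasing s
                   else if all (inK n k) s then increasing s else true

  callanFactor-linked : ∀ {s} → Linked (λ x y → Compatible n x y × x ≢ y) s → T (callanFactor s)
  callanFactor-linked {s} l with all (inN n) s in eqN | all (inK n k) s in eqK
  ... | true  | _     = increasing-linked (linked-< true l (All.map (λ {x} → inN⇒ x) (All.all⁺ (inN n) s (Equivalence.from T-≡ eqN))))
    where
    inN⇒ : ∀ x → T (inN n x) → (x ≤ᵇ n) ≡ true
    inN⇒ x t = T⇒≡true (proj₂ (Equivalence.to (T-∧ {1 ≤ᵇ x}) t))
  ... | false | true  = increasing-linked (linked-< false l (All.map (λ {x} → inK⇒ x) (All.all⁺ (inK n k) s (Equivalence.from T-≡ eqK))))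
    where
    inK⇒ : ∀ x → T (inK n k x) → (x ≤ᵇ n) ≡ false
    inK⇒ x t = >⇒≤ᵇ≡false (ℕ.≤ᵇ⇒≤ (suc n) x (proj₁ (Equivalence.to (T-∧ {suc n ≤ᵇ x}) t)))
  ... | false | false = _

  linked⇒isCallan : ∀ {w} → Unique w → Linked (Compatible n) w → T (isCallan n k w)
  linked⇒isCallan w! l =
    All.all⁻ callanFactor (All.map callanFactor-linked (factors-linked (Linked.zip (l , Linked.AllPairs⇒Linked w!))))

  InRange : ℕ → Set
  InRange x = 1 ≤ x × x ≤ n ℕ.+ k

  -- Two-letter factors suffice for the converse. On a descent inside one class the test computes to
  -- `false`; the range bounds decide membership in N and K.
  callanFactor⇒compatible : ∀ {x y} → InRange x → InRange y → T (callanFactor (x ∷ y ∷ [])) → Compatible n x y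
  callanFactor⇒compatible {x} {y} (1≤x , x≤) (1≤y , y≤) t = cases (y ℕ.<? x) (x ℕ.≤? n) (y ℕ.≤? n)
    where
    cases : Dec (y < x) → Dec (x ≤ n) → Dec (y ≤ n) → Compatible n x y
    cases (no y≮x) _ _ rewrite ≤⇒<ᵇ≡false (ℕ.≮⇒≥ y≮x) = refl
    cases (yes y<x) (yes x≤n) (no y≰n) rewrite ≤⇒≤ᵇ≡true x≤n | >⇒≤ᵇ≡false (ℕ.≰⇒> y≰n) | <⇒<ᵇ≡true y<x = refl
    cases (yes y<x) (no x≰n) (yes y≤n) rewrite >⇒≤ᵇ≡false (ℕ.≰⇒> x≰n) | ≤⇒≤ᵇ≡true y≤n | <⇒<ᵇ≡true y<x = refl
    cases (yes y<x) (yes x≤n) (yes y≤n) = contradiction bad id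
      where
      bad : ⊥
      bad = subst T
        (trans (cong₂ (λ a b → if a ∧ (b ∧ true) then (x <ᵇ y) ∧ true else (if inK n k x ∧ (inK n k y ∧ true) then (x <ᵇ y) ∧ true else true))
                 (cong₂ _∧_ (≤⇒≤ᵇ≡true 1≤x) (≤⇒≤ᵇ≡true x≤n)) (cong₂ _∧_ (≤⇒≤ᵇ≡true 1≤y) (≤⇒≤ᵇ≡true y≤n)))
               (cong (_∧ true) (≤⇒<ᵇ≡false (ℕ.<⇒≤ y<x)))) t
    cases (yes y<x) (no x≰n) (no y≰n) = contradiction bad id
      where
      x>n = ℕ.≰⇒> x≰n
      y>n = ℕ.≰⇒> y≰n
      bad : ⊥
      bad = subst T
        (trans (cong₂ (λ a b → if a ∧ (inN n y ∧ true) then (x <ᵇ y) ∧ true else (if inK n k x ∧ (b ∧ true) then (x <ᵇ y) ∧ true else true))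
                 (cong₂ _∧_ (≤⇒≤ᵇ≡true 1≤x) (>⇒≤ᵇ≡false x>n)) (cong₂ _∧_ (≤⇒≤ᵇ≡true y>n) (≤⇒≤ᵇ≡true y≤)))
        (trans (cong (λ a → if a ∧ true then (x <ᵇ y) ∧ true else true) (cong₂ _∧_ (≤⇒≤ᵇ≡true x>n) (≤⇒≤ᵇ≡true x≤)))
               (cong (_∧ true) (≤⇒<ᵇ≡false (ℕ.<⇒≤ y<x))))) t

  isCallan⇒linked : ∀ {w} → All InRange w → T (isCallan n k w) → Linked (Compatible n) w
  isCallan⇒linked {w} w∈ t = go w∈ (All.all⁺ callanFactor (factors w) t)
    where
    go : ∀ {w} → All InRange w → All (T ∘ callanFactor) (factors w) → Linked (Compatible n) w
    go []              _  = []
    go (_ ∷ [])        _  = [-]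
    -- The third initial segment, after the empty one and the single letter, is the factor x y.
    go {x ∷ y ∷ w} (x∈ ∷ y∈ ∷ w∈) fs@(_ ∷ _ ∷ xy ∷ _) =
      callanFactor⇒compatible x∈ y∈ xy ∷ go (y∈ ∷ w∈) (All.++⁻ʳ (inits (x ∷ y ∷ w)) fs)

  -- The differences of the constant 1: the indicator of d = 0, written with exponent 0 so that
  -- `∑-weight` can start from it.
  ∇₀ : ℕ → ℤ
  ∇₀ d = ∇ d (_^ 0) (+ suc k)

  isCallan-weight : ∀ {w} → w ↭ range1 (n ℕ.+ k) → indicator (isCallan n k w) ≡ weight n ∇₀ w
  isCallan-weight {w} p with isCallan n k w in eq
  ... | true  = sym (weight-linked (isCallan⇒linked inRange (Equivalence.from T-≡ eq)))
    where
    inRange : All InRange w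
    inRange = All-resp-↭ (↭-sym p) (All.applyUpTo⁺₁ suc (n ℕ.+ k) (λ i<n+k → s≤s z≤n , i<n+k))
  ... | false = sym (weight-¬linked w (λ d → ∇-const d 1ℤ (+ suc k)) (subst T eq ∘ linked⇒isCallan w!))
    where
    w! : Unique w
    w! = Unique-resp-↭ (↭-sym p) (range1-unique (n ℕ.+ k))

  numCallan-insertionSum : + numCallan n k ≡ insertionSum k (λ d → ∇ d (_^ n) (+ suc k))
  numCallan-insertionSum = begin
    + numCallan n k
      ≡⟨ length-filterᵇ (isCallan n k) (perms (n ℕ.+ k)) ⟩
    ∑ (perms (n ℕ.+ k)) (indicator ∘ isCallan n k)
      ≡⟨ ∑-cong (perms (n ℕ.+ k)) (λ w∈ → isCallan-weight (∈-perms⁻ (n ℕ.+ k) w∈)) ⟩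
    ∑ (perms (n ℕ.+ k)) (weight n ∇₀)
      -- With `ks` at the tail, all letters of K are inserted before those of N.
      ≡⟨ ∑-↭ _ (perms-↭-insertionPerms ns++ks↭) ⟩
    ∑ (insertionPerms (ns ++ ks)) (weight n ∇₀)
      ≡⟨ subst (λ l → ∑ (insertionPerms (ns ++ ks)) (weight n (λ d → ∇ d (_^ 0) (+ suc l))) ≡
                      ∑ (insertionPerms ks) (weight n (λ d → ∇ d (_^ (length ns ℕ.+ 0)) (+ suc l))))
               |ks| (∑-weight 0 (letters-decreasing 0 n) ns≤n ks>n) ⟩
    ∑ (insertionPerms ks) (weight n (λ d → ∇ d (_^ (length ns ℕ.+ 0)) (+ suc k)))
      ≡⟨ cong (λ m → ∑ (insertionPerms ks) (weight n (λ d → ∇ d (_^ m) (+ suc k)))) (trans (ℕ.+-identityʳ _) (length-applyDownFrom _ n)) ⟩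
    ∑ (insertionPerms ks) (weight n G)
      ≡⟨ ∑-cong (insertionPerms ks) (λ {w} w∈ → weight-K G w (All-resp-↭ (↭-sym (∈-insertionPerms⁻ ks w∈)) ks>n)) ⟩
    ∑ (insertionPerms ks) (G ∘ descents)
      ≡⟨ ∑-descents G (letters-decreasing n k) ⟩
    insertionSum (length ks) G
      ≡⟨ cong (λ l → insertionSum l G) |ks| ⟩
    insertionSum k G ∎
    where
    open ≡-Reasoning
    ns = letters 0 n
    ks = letters n k
    G : ℕ → ℤ
    G d = ∇ d (_^ n) (+ suc k)
    |ks| : length ks ≡ k
    |ks| = length-applyDownFrom _ k
    ns≤n : All (_≤ n) ns
    ns≤n = All.applyDownFrom⁺₁ suc n id
    ks>n : All (n <_) ks
    ks>n = All.applyDownFrom⁺₂ _ k (λ i → s≤s (ℕ.m≤m+n n i))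
    ns++ks↭ : ns ++ ks ↭ range1 (n ℕ.+ k)
    ns++ks↭ = ↭-trans (++-comm ns ks) (↭-trans (↭-reflexive (letters-++ n k)) (letters-↭-range1 (n ℕ.+ k)))

theorem6 : (n k : ℕ) → 0 < n → 0 < k →
    (+ numCallan n k ≡ eulerSum n k) × (eulerSum n k ≡ polyBernoulli n k)
theorem6 n k _ 0<k =
  -- Both sides are the same sum of ∇ᵈ(rⁿ)(k + 1) over permutations of k letters with d descents.
  trans (numCallan-insertionSum n k) (sym (eulerSum-insertionSum n k 0<k)) ,
  (begin
    eulerSum n k                                  ≡⟨ eulerSum-insertionSum n k 0<k ⟩
    insertionSum k (λ d → ∇ d (_^ n) (+ suc k))   ≡⟨ insertionSum-∇ k (_^ n) ⟩
    𝓓^ k (_^ n) 1ℤ                                ≡⟨ 𝓓^-duality k n ⟩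
    𝓓^ n (_^ k) 1ℤ                                ≡⟨ polyBernoulli-𝓓 n k ⟨
    polyBernoulli n k                             ∎)
  where open ≡-Reasoning
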